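{- For each $i\in\{1,\ldots,9\}$, let $\mathsf{Props}_i$ be the set of properties given in the context, let $\Sigma_i$ be the signature consisting of all the operation and relation symbols occurring in $\mathsf{Props}_i$, and let $r_i=(\underline{\mathcal B},T,\underline{\mathcal C}_i,I_i,R_i)$, where: (a) $\underline{\mathcal B}$ is the category of $\Sigma_{\mathsf{ctor}}$-models and $T=\mathcal{T}r(\Sigma_{\mathsf{ctor}})$; (b) $\underline{\mathcal C}_i$ is the category of $(\Sigma_i,\mathsf{Props}_i)$-models (with $\Sigma_i$-model morphisms) and $I_i=\mathcal{T}r(\Sigma_i)$; (c) $R_i:\underline{\mathcal C}_i\to\underline{\mathcal B}$ is the forgetful functor sending $(\Sigma_i,\mathsf{Props}_i)$-models to their underlying $\Sigma_{\mathsf{ctor}}$-models. Then, for every $i\in\{1,\ldots,9\}$, $r_i$ is an epi-recursor. In particular, $\mathcal{T}r(\Sigma_i)$ is the initial $(\Sigma_i,\mathsf{Props}_i)$-model.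
   Context: **Epi-recursors.** An epi-recursor is a tuple $r=(\underline{\mathcal B},T,\underline{\mathcal C},I,R)$ where $\underline{\mathcal B}$ is a category (the base category), $T$ is an object of $\underline{\mathcal B}$ (the base object), $\underline{\mathcal C}$ is a category (the extended category), $I$ is an initial object of $\underline{\mathcal C}$, and $R:\underline{\mathcal C}\to\underline{\mathcal B}$ is a functor with $R\,I=T$. **Terms.** $\mathsf{Var}$ is a countably infinite set of variables. $\mathsf{Tr}$ is the set of $\lambda$-terms over $\mathsf{Var}$, i.e. $\alpha$-equivalence classes of the preterms freely generated by the grammar $p::=\mathsf{PVr}\,x\mid\mathsf{PAp}\,p_1\,p_2\mid\mathsf{PLm}\,x\,p$ (where $\mathsf{PLm}\,x\,p$ binds $x$ in $p$), with induced constructors $\mathsf{Vr}:\mathsf{Var}\to\mathsf{Tr}$, $\mathsf{Ap}:\mathsf{Tr}\to\mathsf{Tr}\to\mathsf{Tr}$, $\mathsf{Lm}:\mathsf{Var}\to\mathsf{Tr}\to\mathsf{Tr}$. $\mathsf{Perm}$ is the set of bijections $\sigma:\mathsf{Var}\to\mathsf{Var}$ with $\mathsf{supp}\,\sigma=\{x\mid\sigma\,x\neq x\}$ finite; $\mathsf{id}$ is the identity; $x\leftrightarrow y$ is the transposition of $x$ and $y$. For variables, $x[z_1\wedge z_2]=(z_1\leftrightarrow z_2)(x)$, and $x[y/z]$ is $y$ if $x=z$ and $x$ otherwise. The standard operators on terms are: permutation $t[\sigma]$ (apply $\sigma$ to all variables of $t$, free, bound and binding), swapping $t[x\wedge y]=t[x\leftrightarrow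 y]$, capture-avoiding substitution $t[s/x]$ of the term $s$ for the variable $x$ in $t$, renaming $t[y/x]=t[(\mathsf{Vr}\,y)/x]$, the free-variable operator $\mathsf{FV}\,t$, and freshness $x\,\#\,t$ iff $x\notin\mathsf{FV}\,t$. **Signatures and models.** The symbols are $\mathsf{vr},\mathsf{ap},\mathsf{lm},\mathsf{pm},\mathsf{sw},\mathsf{sb},\mathsf{ren},\mathsf{fv},\mathsf{fr}$; a signature is a set of symbols. $\Sigma_{\mathsf{ctor}}=\{\mathsf{vr},\mathsf{ap},\mathsf{lm}\}$. A $\Sigma$-model $\mathcal M$ consists of a carrier set $M$ and, for each symbol in $\Sigma$, an operation/relation: $\mathsf{vr}$: $\mathsf{Vr}^{\mathcal M}:\mathsf{Var}\to M$; $\mathsf{ap}$: $\mathsf{Ap}^{\mathcal M}:M\to M\to M$; $\mathsf{lm}$: $\mathsf{Lm}^{\mathcal M}:\mathsf{Var}\to M\to M$; $\mathsf{pm}$: $\_[\_]^{\mathcal M}:M\to\mathsf{Perm}\to M$; $\mathsf{sw}$: $\_[\_\wedge\_]^{\mathcal M}:M\to\mathsf{Var}\to\mathsf{Var}\to M$; $\mathsf{sb}$: $\_[\_/\_]^{\mathcal M}:M\to M\to\mathsf{Var}\to M$; $\mathsf{ren}$: $\_[\_/\_]^{\mathcal M}:M\to\mathsf{Var}\to\mathsf{Var}\to M$; $\mathsf{fv}$: $\mathsf{FV}^{\mathcal M}:M\to\mathcal P(\mathsf{Var})$; $\mathsf{fr}$: $\#^{\mathcal M}:\mathsf{Var}\to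 M\to\mathsf{Bool}$. A morphism $g:\mathcal M\to\mathcal M'$ of $\Sigma$-models is a function $g:M\to M'$ commuting with all the operations for symbols in $\Sigma\cap\{\mathsf{vr},\mathsf{ap},\mathsf{lm},\mathsf{pm},\mathsf{sw},\mathsf{sb},\mathsf{ren}\}$ (e.g. $g(\mathsf{Lm}^{\mathcal M}x\,m)=\mathsf{Lm}^{\mathcal M'}x\,(g\,m)$, $g(m[n/x]^{\mathcal M})=(g\,m)[(g\,n)/x]^{\mathcal M'}$), and such that $x\,\#^{\mathcal M}\,m$ implies $x\,\#^{\mathcal M'}(g\,m)$ if $\mathsf{fr}\in\Sigma$, and $\mathsf{FV}^{\mathcal M'}(g\,m)\subseteq\mathsf{FV}^{\mathcal M}m$ if $\mathsf{fv}\in\Sigma$. $\mathcal{T}r(\Sigma)$ is the $\Sigma$-model with carrier $\mathsf{Tr}$ and the standard operators on terms. **Properties** (interpreted in a model $\mathcal M$, superscripts omitted; $m,m_1,m_2,n$ range over $M$; $x,x',x_i,y,y_i,z,z_i$ over $\mathsf{Var}$; $\sigma,\tau$ over $\mathsf{Perm}$; all universally quantified unless said otherwise). Swapping: SwVr: $(\mathsf{Vr}\,x)[z_1\wedge z_2]=\mathsf{Vr}(x[z_1\wedge z_2])$. SwAp: $(\mathsf{Ap}\,m_1\,m_2)[z_1\wedge z_2]=\mathsf{Ap}(m_1[z_1\wedge z_2])(m_2[z_1\wedge z_2])$. SwLm: $(\mathsf{Lm}\,x\,m)[z_1\wedge z_2]=\mathsf{Lm}(x[z_1\wedge z_2])(m[z_1\wedge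 z_2])$. SwId: $m[z\wedge z]=m$. SwIv: $m[x\wedge y][x\wedge y]=m$. SwCp: $m[x\wedge y][z_1\wedge z_2]=(m[z_1\wedge z_2])[(x[z_1\wedge z_2])\wedge(y[z_1\wedge z_2])]$. SwFv: if $x,y\notin\mathsf{FV}\,m$ then $m[x\wedge y]=m$. SwCg: if $z\notin\{x_1,x_2\}$, $z\,\#\,m_1$, $z\,\#\,m_2$ and $m_1[z\wedge x_1]=m_2[z\wedge x_2]$ then $\mathsf{Lm}\,x_1\,m_1=\mathsf{Lm}\,x_2\,m_2$. SwBvr: if $x'\neq x$ and $x'\,\#\,m$ then $\mathsf{Lm}\,x\,m=\mathsf{Lm}\,x'(m[x'\wedge x])$. Permutation: PmVr: $(\mathsf{Vr}\,x)[\sigma]=\mathsf{Vr}(\sigma\,x)$. PmAp: $(\mathsf{Ap}\,m_1\,m_2)[\sigma]=\mathsf{Ap}(m_1[\sigma])(m_2[\sigma])$. PmLm: $(\mathsf{Lm}\,x\,m)[\sigma]=\mathsf{Lm}(\sigma\,x)(m[\sigma])$. PmId: $m[\mathsf{id}]=m$. PmCp: $m[\sigma][\tau]=m[\tau\circ\sigma]$. PmFv: if $\mathsf{supp}\,\sigma\cap\mathsf{FV}\,m=\emptyset$ then $m[\sigma]=m$. Substitution: SbVr: $(\mathsf{Vr}\,x)[n/z]=$ (if $x=z$ then $n$ else $\mathsf{Vr}\,x$). SbAp: $(\mathsf{Ap}\,m_1\,m_2)[n/z]=\mathsf{Ap}(m_1[n/z])(m_2[n/z])$. SbLm: if $x\neq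 z$ and $x\,\#\,n$ then $(\mathsf{Lm}\,x\,m)[n/z]=\mathsf{Lm}\,x(m[n/z])$. SbBvr: if $x'\neq x$ and $x'\,\#\,m$ then $\mathsf{Lm}\,x\,m=\mathsf{Lm}\,x'(m[(\mathsf{Vr}\,x')/x])$. Renaming: RnVr: $(\mathsf{Vr}\,x)[y/z]=\mathsf{Vr}(x[y/z])$. RnAp: $(\mathsf{Ap}\,m_1\,m_2)[y/z]=\mathsf{Ap}(m_1[y/z])(m_2[y/z])$. RnLm$_1$: if $x\notin\{y,z\}$ then $(\mathsf{Lm}\,x\,m)[y/z]=\mathsf{Lm}\,x(m[y/z])$. RnLm$_2$: $(\mathsf{Lm}\,x\,m)[z/x]=\mathsf{Lm}\,x\,m$. RnBvr: if $x'\neq x$ and $x'\,\#\,m$ then $\mathsf{Lm}\,x\,m=\mathsf{Lm}\,x'(m[x'/x])$. RnBvr$_2$: if $y\neq x'$ then $\mathsf{Lm}\,x(m[y/x'])=\mathsf{Lm}\,x'(m[y/x'][x'/x])$. RnId: $m[z/z]=m$. RnIm: if $x_1\neq y$ then $m[x_1/y][x_2/y]=m[x_1/y]$. RnCh: if $y\neq x_2$ then $m[y/x_2][x_2/x_1][x_3/x_2]=m[y/x_2][x_3/x_1]$. RnCm: if $x_2\neq y_1\neq x_1\neq y_2$ then $m[x_2/x_1][y_2/y_1]=m[y_2/y_1][x_2/x_1]$. Freshness/freeness: FrVr: if $z\neq x$ then $z\,\#\,\mathsf{Vr}\,x$. FrAp: if $z\,\#\,m_1$ and $z\,\#\,m_2$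 then $z\,\#\,\mathsf{Ap}\,m_1\,m_2$. FrLm: if $z=x$ or $z\,\#\,m$ then $z\,\#\,\mathsf{Lm}\,x\,m$. FvVr: $\mathsf{FV}(\mathsf{Vr}\,x)\subseteq\{x\}$. FvAp: $\mathsf{FV}(\mathsf{Ap}\,m_1\,m_2)\subseteq\mathsf{FV}\,m_1\cup\mathsf{FV}\,m_2$. FvLm: $\mathsf{FV}(\mathsf{Lm}\,x\,m)\subseteq\mathsf{FV}\,m\setminus\{x\}$. FvDPm: $\mathsf{FV}\,m=\{x\mid\{y\mid m[x\leftrightarrow y]\neq m\}\text{ is infinite}\}$. FvDSw: $\mathsf{FV}\,m=\{x\mid\{y\mid m[x\wedge y]\neq m\}\text{ is infinite}\}$. FCB: there exists $x\in\mathsf{Var}$ such that $x\notin\mathsf{FV}(\mathsf{Lm}\,x\,m)$ for all $m\in M$. A $(\Sigma,\mathsf{Props})$-model is a $\Sigma$-model satisfying all properties in $\mathsf{Props}$. **The sets $\mathsf{Props}_i$.** $\mathsf{Props}_1$ (perm/free): PmVr, PmAp, PmLm, PmId, PmCp, FvDPm, FCB. $\mathsf{Props}_2$ (perm/free variant): PmVr, PmAp, PmLm, PmId, PmCp, PmFv, FvVr, FvAp, FvLm. $\mathsf{Props}_3$ (swap/free variant): SwVr, SwAp, SwLm, SwId, SwIv, SwCp, FvDSw, FCB. $\mathsf{Props}_4$ (swap/free): SwVr, SwAp, SwLm, SwFv, FvVr, FvAp, FvLm. $\mathsf{Props}_5$ (swap/fresh variant): SwVr, SwAp, SwLm, SwBvr,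 FrVr, FrAp, FrLm. $\mathsf{Props}_6$ (swap/fresh): SwVr, SwAp, SwLm, SwCg, FrVr, FrAp, FrLm. $\mathsf{Props}_7$ (subst/fresh): SbVr, SbAp, SbLm, SbBvr, FrVr, FrAp, FrLm. $\mathsf{Props}_8$ (renaming): RnVr, RnAp, RnLm$_1$, RnLm$_2$, RnBvr$_2$, RnId, RnIm, RnCh, RnCm. $\mathsf{Props}_9$ (renaming/fresh variant): RnVr, RnAp, RnLm$_1$, RnBvr, FrVr, FrAp, FrLm. -}

module Defs where

open import Level using (Level; _⊔_) renaming (suc to lsuc)
open import Data.Bool.Base using (Bool; true; false; T; if_then_else_; _∨_)
open import Data.Bool.ListAction using (any)
open import Data.Fin.Base using (Fin)
open import Data.Fin.Patterns using (0F; 1F; 2F; 3F; 4F; 5F; 6F; 7F; 8F)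
open import Data.List.Base using (List; []; _∷_; _++_; map; concatMap)
open import Data.List.Membership.Propositional using (lose)
open import Data.List.Membership.Propositional.Properties
  using (∈-++⁺ˡ; ∈-++⁺ʳ; ∈-map⁺; ∈-map⁻; ∈-concatMap⁺)
open import Data.List.Properties using (map-++)
open import Data.List.Relation.Unary.All using (All)
open import Data.List.Relation.Unary.Any using (here; there)
open import Data.Nat.Base using (ℕ; suc; _≤_)
open import Data.Nat.ListAction using (sum)
open import Data.Nat.Properties using (m≤m+n; m≤n+m; ≤-trans; 1+n≰n) renaming (_≟_ to _≟ℕ_)
open import Data.Product.Base using (Σ-syntax; ∃-syntax; _×_; _,_; proj₁; proj₂)
open import Data.Sum.Base using (_⊎_; inj₁; inj₂)
open import Data.Unit.Base using (tt)
open import Data.Vec.Base using ([]; _∷_; lookup)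
open import Function.Base using (_∘_; id)
open import Function.Bundles using (_↔_; mk↔ₛ′; Inverse)
open import Function.Construct.Composition using (_↔-∘_)
open import Function.Construct.Identity using (↔-id)
open import Function.Definitions using (Injective)
open import Relation.Binary.Bundles using (Setoid)
open import Relation.Binary.Definitions using (DecidableEquality)
open import Relation.Binary.PropositionalEquality
  using (_≡_; _≢_; refl; sym; trans; cong; cong₂; subst; subst₂)
open import Relation.Binary.Structures using (IsEquivalence)
open import Relation.Nullary using (¬_; Dec; yes; no; does; contradiction)
open import Relation.Unary using (Pred; ｛_｝; _∪_; _∩_; _∖_; _∈_; _∉_; _⊆_; _≐_; Empty)

import Data.List.Membership.Propositional as List

------------------------------------------------------------------------

record Category (o h e : Level) : Set (lsuc (o ⊔ h ⊔ e)) where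
  infix  4 _≈_
  infixr 9 _∘ᶜ_
  field
    Obj   : Set o
    Hom   : Obj → Obj → Set h
    _≈_   : ∀ {A B} → Hom A B → Hom A B → Set e
    equiv : ∀ {A B} → IsEquivalence (_≈_ {A} {B})
    idᶜ   : ∀ {A} → Hom A A
    _∘ᶜ_  : ∀ {A B C} → Hom B C → Hom A B → Hom A C
    ∘-resp-≈  : ∀ {A B C} {f f′ : Hom B C} {g g′ : Hom A B} →
                f ≈ f′ → g ≈ g′ → f ∘ᶜ g ≈ f′ ∘ᶜ g′
    identityˡ : ∀ {A B} (f : Hom A B) → idᶜ ∘ᶜ f ≈ f
    identityʳ : ∀ {A B} (f : Hom A B) → f ∘ᶜ idᶜ ≈ f
    assoc     : ∀ {A B C D} (f : Hom C D) (g : Hom B C) (h : Hom A B) →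
                (f ∘ᶜ g) ∘ᶜ h ≈ f ∘ᶜ (g ∘ᶜ h)

record Functor {o h e o′ h′ e′} (C : Category o h e) (D : Category o′ h′ e′) :
               Set (o ⊔ h ⊔ e ⊔ o′ ⊔ h′ ⊔ e′) where
  module C = Category C
  module D = Category D
  field
    F₀ : C.Obj → D.Obj
    F₁ : ∀ {A B} → C.Hom A B → D.Hom (F₀ A) (F₀ B)
    F-resp-≈ : ∀ {A B} {f g : C.Hom A B} → f C.≈ g → F₁ f D.≈ F₁ g
    F-id : ∀ {A} → F₁ (C.idᶜ {A}) D.≈ D.idᶜ
    F-∘  : ∀ {A B E} (f : C.Hom B E) (g : C.Hom A B) → F₁ (f C.∘ᶜ g) D.≈ F₁ f D.∘ᶜ F₁ g

module _ {o h e} (C : Category o h e) where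
  open Category C

  IsInitial : Obj → Set (o ⊔ h ⊔ e)
  IsInitial I = ∀ A → Σ[ f ∈ Hom I A ] (∀ (g : Hom I A) → g ≈ f)

  FullSubcategory : ∀ {p} → (Obj → Set p) → Category (o ⊔ p) h e
  FullSubcategory P = record
    { Obj = Σ[ A ∈ Obj ] P A
    ; Hom = λ A B → Hom (proj₁ A) (proj₁ B)
    ; _≈_ = _≈_
    ; equiv = equiv
    ; idᶜ = idᶜ
    ; _∘ᶜ_ = _∘ᶜ_
    ; ∘-resp-≈ = ∘-resp-≈
    ; identityˡ = identityˡ
    ; identityʳ = identityʳ
    ; assoc = assoc
    }

-- The tuple (B, T, C, I, R), without the conditions on I and R.
record Tuple (o h e o′ h′ e′ : Level) : Set (lsuc (o ⊔ h ⊔ e ⊔ o′ ⊔ h′ ⊔ e′)) where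
  field
    B : Category o h e
    base : Category.Obj B
    C : Category o′ h′ e′
    I : Category.Obj C
    R : Functor C B

record IsEpiRecursor {o h e o′ h′ e′} (r : Tuple o h e o′ h′ e′) :
                     Set (o ⊔ h ⊔ e ⊔ o′ ⊔ h′ ⊔ e′) where
  open Tuple r
  field
    I-initial : IsInitial C I
    RI≡T      : Functor.F₀ R I ≡ base

------------------------------------------------------------------------

data Symbol : Set where
  vr ap lm pm sw sb ren fv fr : Symbol

_==_ : Symbol → Symbol → Bool
vr  == vr  = true
ap  == ap  = true
lm  == lm  = true
pm  == pm  = true
sw  == sw  = true
sb  == sb  = true
ren == ren = true
fv  == fv  = true
fr  == fr  = true
_   == _   = false

Signature : Set
Signature = Symbol → Bool

infix 4 _∈ˢ_ _⊆ˢ_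

-- For a closed signature s ∈ˢ S reduces to ⊤ or ⊥, so that the instance
-- arguments of this type below are found automatically.
_∈ˢ_ : Symbol → Signature → Set
s ∈ˢ S = T (S s)

_⊆ˢ_ : Signature → Signature → Set
S ⊆ˢ S′ = ∀ {s} → s ∈ˢ S → s ∈ˢ S′

sig : List Symbol → Signature
sig ss s = any (s ==_) ss

Σctor : Signature
Σctor = sig (vr ∷ ap ∷ lm ∷ [])

------------------------------------------------------------------------

data Property : Set where
  SwVr SwAp SwLm SwId SwIv SwCp SwFv SwCg SwBvr : Property
  PmVr PmAp PmLm PmId PmCp PmFv : Property
  SbVr SbAp SbLm SbBvr : Property
  RnVr RnAp RnLm₁ RnLm₂ RnBvr RnBvr₂ RnId RnIm RnCh RnCm : Property
  FrVr FrAp FrLm FvVr FvAp FvLm FvDPm FvDSw FCB : Property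

symbols : Property → Signature
symbols SwVr   = sig (vr ∷ sw ∷ [])
symbols SwAp   = sig (ap ∷ sw ∷ [])
symbols SwLm   = sig (lm ∷ sw ∷ [])
symbols SwId   = sig (sw ∷ [])
symbols SwIv   = sig (sw ∷ [])
symbols SwCp   = sig (sw ∷ [])
symbols SwFv   = sig (sw ∷ fv ∷ [])
symbols SwCg   = sig (lm ∷ sw ∷ fr ∷ [])
symbols SwBvr  = sig (lm ∷ sw ∷ fr ∷ [])
symbols PmVr   = sig (vr ∷ pm ∷ [])
symbols PmAp   = sig (ap ∷ pm ∷ [])
symbols PmLm   = sig (lm ∷ pm ∷ [])
symbols PmId   = sig (pm ∷ [])
symbols PmCp   = sig (pm ∷ [])
symbols PmFv   = sig (pm ∷ fv ∷ [])
symbols SbVr   = sig (vr ∷ sb ∷ [])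
symbols SbAp   = sig (ap ∷ sb ∷ [])
symbols SbLm   = sig (lm ∷ sb ∷ fr ∷ [])
symbols SbBvr  = sig (vr ∷ lm ∷ sb ∷ fr ∷ [])
symbols RnVr   = sig (vr ∷ ren ∷ [])
symbols RnAp   = sig (ap ∷ ren ∷ [])
symbols RnLm₁  = sig (lm ∷ ren ∷ [])
symbols RnLm₂  = sig (lm ∷ ren ∷ [])
symbols RnBvr  = sig (lm ∷ ren ∷ fr ∷ [])
symbols RnBvr₂ = sig (lm ∷ ren ∷ [])
symbols RnId   = sig (ren ∷ [])
symbols RnIm   = sig (ren ∷ [])
symbols RnCh   = sig (ren ∷ [])
symbols RnCm   = sig (ren ∷ [])
symbols FrVr   = sig (vr ∷ fr ∷ [])
symbols FrAp   = sig (ap ∷ fr ∷ [])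
symbols FrLm   = sig (lm ∷ fr ∷ [])
symbols FvVr   = sig (vr ∷ fv ∷ [])
symbols FvAp   = sig (ap ∷ fv ∷ [])
symbols FvLm   = sig (lm ∷ fv ∷ [])
symbols FvDPm  = sig (pm ∷ fv ∷ [])
symbols FvDSw  = sig (sw ∷ fv ∷ [])
symbols FCB    = sig (lm ∷ fv ∷ [])

occurring : List Property → Signature
occurring Ps s = any (λ P → symbols P s) Ps

Props : Fin 9 → List Property
Props = lookup
  ( (PmVr ∷ PmAp ∷ PmLm ∷ PmId ∷ PmCp ∷ FvDPm ∷ FCB ∷ [])
  ∷ (PmVr ∷ PmAp ∷ PmLm ∷ PmId ∷ PmCp ∷ PmFv ∷ FvVr ∷ FvAp ∷ FvLm ∷ [])
  ∷ (SwVr ∷ SwAp ∷ SwLm ∷ SwId ∷ SwIv ∷ SwCp ∷ FvDSw ∷ FCB ∷ [])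
  ∷ (SwVr ∷ SwAp ∷ SwLm ∷ SwFv ∷ FvVr ∷ FvAp ∷ FvLm ∷ [])
  ∷ (SwVr ∷ SwAp ∷ SwLm ∷ SwBvr ∷ FrVr ∷ FrAp ∷ FrLm ∷ [])
  ∷ (SwVr ∷ SwAp ∷ SwLm ∷ SwCg ∷ FrVr ∷ FrAp ∷ FrLm ∷ [])
  ∷ (SbVr ∷ SbAp ∷ SbLm ∷ SbBvr ∷ FrVr ∷ FrAp ∷ FrLm ∷ [])
  ∷ (RnVr ∷ RnAp ∷ RnLm₁ ∷ RnLm₂ ∷ RnBvr₂ ∷ RnId ∷ RnIm ∷ RnCh ∷ RnCm ∷ [])
  ∷ (RnVr ∷ RnAp ∷ RnLm₁ ∷ RnBvr ∷ FrVr ∷ FrAp ∷ FrLm ∷ [])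
  ∷ [])

Sig : Fin 9 → Signature
Sig i = occurring (Props i)

Σctor⊆Sig : ∀ i → Σctor ⊆ˢ Sig i
Σctor⊆Sig i {s} = incl s (ctors i)
  where
  ctors : ∀ i → vr ∈ˢ Sig i × ap ∈ˢ Sig i × lm ∈ˢ Sig i
  ctors 0F = tt , tt , tt
  ctors 1F = tt , tt , tt
  ctors 2F = tt , tt , tt
  ctors 3F = tt , tt , tt
  ctors 4F = tt , tt , tt
  ctors 5F = tt , tt , tt
  ctors 6F = tt , tt , tt
  ctors 7F = tt , tt , tt
  ctors 8F = tt , tt , tt

  incl : ∀ s → vr ∈ˢ Sig i × ap ∈ˢ Sig i × lm ∈ˢ Sig i → s ∈ˢ Σctor → s ∈ˢ Sig i
  incl vr (p , _ , _) _ = p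
  incl ap (_ , p , _) _ = p
  incl lm (_ , _ , p) _ = p

------------------------------------------------------------------------

Finite : ∀ {a p} {A : Set a} → Pred A p → Set (a ⊔ p)
Finite P = ∃[ xs ] (∀ {x} → x ∈ P → x List.∈ xs)

Infinite : ∀ {a p} {A : Set a} → Pred A p → Set (a ⊔ p)
Infinite P = ¬ Finite P

------------------------------------------------------------------------

module Lambda {ℓ : Level} (Var : Set ℓ) (enum : Var ↔ ℕ) where

  open Inverse using (to; from)

  inverseˡ : ∀ n → to enum (from enum n) ≡ n
  inverseˡ n = Inverse.inverseˡ enum refl

  inverseʳ : ∀ x → from enum (to enum x) ≡ x
  inverseʳ x = Inverse.inverseʳ enum refl

  infix 4 _≟_

  opaque
    _≟_ : DecidableEquality Var
    x ≟ y with to enum x ≟ℕ to enum y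
    ... | yes e = yes (trans (sym (inverseʳ x)) (trans (cong (from enum) e) (inverseʳ y)))
    ... | no ¬e = no (¬e ∘ cong (to enum))

  fresh : List Var → Var
  fresh xs = from enum (suc (sum (map (to enum) xs)))

  fresh-∉ : ∀ xs → ¬ (fresh xs List.∈ xs)
  fresh-∉ xs p = 1+n≰n (subst (_≤ sum (map (to enum) xs)) (inverseˡ _) (bound p))
    where
    bound : ∀ {x xs} → x List.∈ xs → to enum x ≤ sum (map (to enum) xs)
    bound (here refl) = m≤m+n _ _
    bound {xs = y ∷ _} (there q) = ≤-trans (bound q) (m≤n+m _ (to enum y))

  -- The transposition x ↔ y as a function; swap x y z is z [ x ∧ y ].
  swap : Var → Var → Var → Var
  swap x y z = if does (z ≟ x) then y else if does (z ≟ y) then x else z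

  -- renVar y z x is x [ y / z ].
  renVar : Var → Var → Var → Var
  renVar y z x = if does (x ≟ z) then y else x

  Inj : (Var → Var) → Set ℓ
  Inj = Injective _≡_ _≡_

  swapˡ : ∀ x y → swap x y x ≡ y
  swapˡ x y with x ≟ x
  ... | yes _ = refl
  ... | no ¬p = contradiction refl ¬p

  swapʳ : ∀ x y → swap x y y ≡ x
  swapʳ x y with y ≟ x
  ... | yes p = p
  ... | no _ with y ≟ y
  ...   | yes _ = refl
  ...   | no ¬p = contradiction refl ¬p

  swap-≢ : ∀ x y {z} → z ≢ x → z ≢ y → swap x y z ≡ z
  swap-≢ x y {z} p q with z ≟ x
  ... | yes e = contradiction e p
  ... | no _ with z ≟ y
  ...   | yes e = contradiction e q
  ...   | no _ = refl

  data SwapView (x y z : Var) : Set ℓ where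
    is-x : z ≡ x → swap x y z ≡ y → SwapView x y z
    is-y : z ≡ y → swap x y z ≡ x → SwapView x y z
    is-z : z ≢ x → z ≢ y → swap x y z ≡ z → SwapView x y z

  swapView : ∀ x y z → SwapView x y z
  swapView x y z with z ≟ x
  ... | yes refl = is-x refl (swapˡ x y)
  ... | no p with z ≟ y
  ...   | yes refl = is-y refl (swapʳ x y)
  ...   | no q = is-z p q (swap-≢ x y p q)

  swap-invol : ∀ x y z → swap x y (swap x y z) ≡ z
  swap-invol x y z with swapView x y z
  ... | is-x refl e = trans (cong (swap x y) e) (swapʳ x y)
  ... | is-y refl e = trans (cong (swap x y) e) (swapˡ x y)
  ... | is-z _ _ e = trans (cong (swap x y) e) e

  swap-inj : ∀ x y → Inj (swap x y)
  swap-inj x y {u} {v} e =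
    trans (sym (swap-invol x y u)) (trans (cong (swap x y) e) (swap-invol x y v))

  swap-conj : ∀ {σ} → Inj σ → ∀ x y z → σ (swap x y z) ≡ swap (σ x) (σ y) (σ z)
  swap-conj {σ} i x y z with swapView x y z
  ... | is-x refl e = trans (cong σ e) (sym (swapˡ _ _))
  ... | is-y refl e = trans (cong σ e) (sym (swapʳ _ _))
  ... | is-z p q e = trans (cong σ e) (sym (swap-≢ _ _ (p ∘ i) (q ∘ i)))

  ----------------------------------------------------------------------

  record Perm : Set ℓ where
    field
      bij : Var ↔ Var
      finite-supp : Finite (λ x → to bij x ≢ x)

  ⟪_⟫ : Perm → Var → Var
  ⟪ σ ⟫ = to (Perm.bij σ)

  supp : Perm → Pred Var ℓ
  supp σ x = ⟪ σ ⟫ x ≢ x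

  idᵖ : Perm
  idᵖ = record { bij = ↔-id Var ; finite-supp = [] , λ p → contradiction refl p }

  infixr 9 _∘ᵖ_

  _∘ᵖ_ : Perm → Perm → Perm
  τ ∘ᵖ σ = record
    { bij = Perm.bij τ ↔-∘ Perm.bij σ
    ; finite-supp = proj₁ (Perm.finite-supp σ) ++ proj₁ (Perm.finite-supp τ) , in-supp
    }
    where
    in-supp : ∀ {x} → ⟪ τ ⟫ (⟪ σ ⟫ x) ≢ x →
              x List.∈ (proj₁ (Perm.finite-supp σ) ++ proj₁ (Perm.finite-supp τ))
    in-supp {x} p with ⟪ σ ⟫ x ≟ x
    ... | yes e = ∈-++⁺ʳ (proj₁ (Perm.finite-supp σ))
                    (proj₂ (Perm.finite-supp τ) λ e′ → p (trans (cong ⟪ τ ⟫ e) e′))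
    ... | no q  = ∈-++⁺ˡ (proj₂ (Perm.finite-supp σ) q)

  transposition : Var → Var → Perm
  transposition x y = record
    { bij = mk↔ₛ′ (swap x y) (swap x y) (swap-invol x y) (swap-invol x y)
    ; finite-supp = x ∷ y ∷ [] , in-supp
    }
    where
    in-supp : ∀ {z} → swap x y z ≢ z → z List.∈ (x ∷ y ∷ [])
    in-supp {z} p with swapView x y z
    ... | is-x e _ = here e
    ... | is-y e _ = there (here e)
    ... | is-z _ _ e = contradiction e p

  perm-inj : ∀ σ → Inj ⟪ σ ⟫
  perm-inj σ {u} {v} e =
    trans (sym (Inverse.inverseʳ (Perm.bij σ) refl)) (Inverse.inverseʳ (Perm.bij σ) e)

  ----------------------------------------------------------------------

  data Preterm : Set ℓ where
    PVr : Var → Preterm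
    PAp : Preterm → Preterm → Preterm
    PLm : Var → Preterm → Preterm

  -- All variables of a preterm: free, bound and binding.
  vars : Preterm → List Var
  vars (PVr x)   = x ∷ []
  vars (PAp p q) = vars p ++ vars q
  vars (PLm x p) = x ∷ vars p

  FVᵖ : Preterm → Pred Var ℓ
  FVᵖ (PVr x)   = ｛ x ｝
  FVᵖ (PAp p q) = FVᵖ p ∪ FVᵖ q
  FVᵖ (PLm x p) = FVᵖ p ∖ ｛ x ｝

  act : (Var → Var) → Preterm → Preterm
  act σ (PVr x)   = PVr (σ x)
  act σ (PAp p q) = PAp (act σ p) (act σ q)
  act σ (PLm x p) = PLm (σ x) (act σ p)

  infix 4 _=α_

  data _=α_ : Preterm → Preterm → Set ℓ where
    =PVr : ∀ {x} → PVr x =α PVr x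
    =PAp : ∀ {p p′ q q′} → p =α p′ → q =α q′ → PAp p q =α PAp p′ q′
    =PLm : ∀ {x y p q} z →
         ¬ (z List.∈ vars (PLm x p)) → ¬ (z List.∈ vars (PLm y q)) →
         act (swap x z) p =α act (swap y z) q →
         PLm x p =α PLm y q

  vars-act : ∀ σ p → vars (act σ p) ≡ map σ (vars p)
  vars-act σ (PVr x)   = refl
  vars-act σ (PAp p q) =
    trans (cong₂ _++_ (vars-act σ p) (vars-act σ q)) (sym (map-++ σ (vars p) (vars q)))
  vars-act σ (PLm x p) = cong (σ x ∷_) (vars-act σ p)

  ∈-vars-act⁺ : ∀ σ p {v} → v List.∈ vars p → σ v List.∈ vars (act σ p)
  ∈-vars-act⁺ σ p m = subst (_ List.∈_) (sym (vars-act σ p)) (∈-map⁺ σ m)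

  ∉-vars-act : ∀ {σ} → Inj σ → ∀ p {v} → ¬ (v List.∈ vars p) → ¬ (σ v List.∈ vars (act σ p))
  ∉-vars-act {σ} i p n m with ∈-map⁻ σ (subst (_ List.∈_) (vars-act σ p) m)
  ... | u , u∈ , e = n (subst (List._∈ vars p) (sym (i e)) u∈)

  act-ext : ∀ {σ τ} p → (∀ {v} → v List.∈ vars p → σ v ≡ τ v) → act σ p ≡ act τ p
  act-ext (PVr x)   h = cong PVr (h (here refl))
  act-ext (PAp p q) h = cong₂ PAp (act-ext p (h ∘ ∈-++⁺ˡ)) (act-ext q (h ∘ ∈-++⁺ʳ (vars p)))
  act-ext (PLm x p) h = cong₂ PLm (h (here refl)) (act-ext p (h ∘ there))

  act-∘ : ∀ σ τ p → act σ (act τ p) ≡ act (σ ∘ τ) p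
  act-∘ σ τ (PVr x)   = refl
  act-∘ σ τ (PAp p q) = cong₂ PAp (act-∘ σ τ p) (act-∘ σ τ q)
  act-∘ σ τ (PLm x p) = cong (PLm _) (act-∘ σ τ p)

  act-id : ∀ p → act id p ≡ p
  act-id (PVr x)   = refl
  act-id (PAp p q) = cong₂ PAp (act-id p) (act-id q)
  act-id (PLm x p) = cong (PLm x) (act-id p)

  ≢-of-∉ : ∀ {v u : Var} {xs} → v List.∈ xs → ¬ (u List.∈ xs) → v ≢ u
  ≢-of-∉ m n refl = n m

  act-swap-∉ : ∀ {x y} p → ¬ (x List.∈ vars p) → ¬ (y List.∈ vars p) → act (swap x y) p ≡ p
  act-swap-∉ {x} {y} p x∉ y∉ =
    trans (act-ext p λ m → swap-≢ x y (≢-of-∉ m x∉) (≢-of-∉ m y∉)) (act-id p)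

  act-swap-swap : ∀ {x z w} p → ¬ (z List.∈ vars p) → ¬ (w List.∈ vars p) →
                  act (swap z w) (act (swap x z) p) ≡ act (swap x w) p
  act-swap-swap {x} {z} {w} p z∉ w∉ = trans (act-∘ _ _ p) (act-ext p pointwise)
    where
    pointwise : ∀ {v} → v List.∈ vars p → swap z w (swap x z v) ≡ swap x w v
    pointwise {v} m with swapView x z v
    ... | is-x refl e = trans (cong (swap z w) e) (trans (swapˡ z w) (sym (swapˡ x w)))
    ... | is-y refl _ = contradiction m z∉
    ... | is-z p q e  = trans (cong (swap z w) e)
                          (trans (swap-≢ z w q (≢-of-∉ m w∉)) (sym (swap-≢ x w p (≢-of-∉ m w∉))))

  α-act : ∀ {σ} → Inj σ → ∀ {p q} → p =α q → act σ p =α act σ q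
  α-act i =PVr = =PVr
  α-act i (=PAp d e) = =PAp (α-act i d) (α-act i e)
  α-act {σ} i (=PLm {x} {y} {p} {q} z n n′ d) =
    =PLm (σ z) (∉-vars-act i (PLm x p) n) (∉-vars-act i (PLm y q) n′)
       (subst₂ _=α_ (commute x p) (commute y q) (α-act i d))
    where
    commute : ∀ x p → act σ (act (swap x z) p) ≡ act (swap (σ x) (σ z)) (act σ p)
    commute x p = trans (act-∘ _ _ p)
      (trans (act-ext p λ {v} _ → swap-conj i x z v) (sym (act-∘ _ _ p)))

  lm⁻ : ∀ {x y p q} → PLm x p =α PLm y q → ∀ w →
        ¬ (w List.∈ vars (PLm x p)) → ¬ (w List.∈ vars (PLm y q)) →
        act (swap x w) p =α act (swap y w) q
  lm⁻ {p = p} {q} (=PLm z n n′ d) w m m′ =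
    subst₂ _=α_ (act-swap-swap p (n ∘ there) (m ∘ there)) (act-swap-swap q (n′ ∘ there) (m′ ∘ there))
      (α-act (swap-inj z w) d)

  ∉-++ˡ : ∀ {w : Var} {xs ys} → ¬ (w List.∈ (xs ++ ys)) → ¬ (w List.∈ xs)
  ∉-++ˡ n = n ∘ ∈-++⁺ˡ

  ∉-++ʳ : ∀ {w : Var} xs {ys} → ¬ (w List.∈ (xs ++ ys)) → ¬ (w List.∈ ys)
  ∉-++ʳ xs n = n ∘ ∈-++⁺ʳ xs

  α-lm : ∀ {x p q} → p =α q → PLm x p =α PLm x q
  α-lm {x} {p} {q} d =
    =PLm w (∉-++ˡ w∉) (∉-++ʳ (vars (PLm x p)) w∉) (α-act (swap-inj x w) d)
    where
    w = fresh (vars (PLm x p) ++ vars (PLm x q))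
    w∉ = fresh-∉ (vars (PLm x p) ++ vars (PLm x q))

  α-refl : ∀ p → p =α p
  α-refl (PVr x)   = =PVr
  α-refl (PAp p q) = =PAp (α-refl p) (α-refl q)
  α-refl (PLm x p) = α-lm (α-refl p)

  α-reflexive : ∀ {p q} → p ≡ q → p =α q
  α-reflexive refl = α-refl _

  α-sym : ∀ {p q} → p =α q → q =α p
  α-sym =PVr = =PVr
  α-sym (=PAp d e) = =PAp (α-sym d) (α-sym e)
  α-sym (=PLm z n n′ d) = =PLm z n′ n (α-sym d)

  α-trans-act : ∀ q σ {p r} → p =α act σ q → act σ q =α r → p =α r
  α-trans-act (PVr x)   σ =PVr =PVr = =PVr
  α-trans-act (PAp q q′) σ (=PAp d d′) (=PAp e e′) = =PAp (α-trans-act q σ d e) (α-trans-act q′ σ d′ e′)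
  α-trans-act (PLm y q) σ {PLm x p} {PLm u r} d e = =PLm w w∉₁ w∉₃
    (α-trans-act q (swap (σ y) w ∘ σ)
      (subst (act (swap x w) p =α_) (act-∘ _ _ q) (lm⁻ d w w∉₁ w∉₂))
      (subst (_=α act (swap u w) r) (act-∘ _ _ q) (lm⁻ e w w∉₂ w∉₃)))
    where
    l₁ = vars (PLm x p)
    l₂ = vars (act σ (PLm y q))
    l₃ = vars (PLm u r)
    w = fresh (l₁ ++ l₂ ++ l₃)
    w∉ = fresh-∉ (l₁ ++ l₂ ++ l₃)
    w∉₁ = ∉-++ˡ w∉
    w∉₂ = ∉-++ˡ (∉-++ʳ l₁ w∉)
    w∉₃ = ∉-++ʳ l₂ (∉-++ʳ l₁ w∉)

  α-trans : ∀ {p q r} → p =α q → q =α r → p =α r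
  α-trans {q = q} d e =
    α-trans-act q id (subst (_ =α_) (sym (act-id q)) d) (subst (_=α _) (sym (act-id q)) e)

  -- λ-terms: quotients are represented by setoids.
  Term : Setoid ℓ ℓ
  Term = record
    { Carrier = Preterm
    ; _≈_ = _=α_
    ; isEquivalence = record { refl = α-refl _ ; sym = α-sym ; trans = α-trans }
    }

  ----------------------------------------------------------------------

  infix 9 _[_≔_]

  _[_≔_] : (Var → Preterm) → Var → Preterm → Var → Preterm
  (ρ [ x ≔ s ]) y = if does (y ≟ x) then s else ρ y

  -- Simultaneous substitution.  Every binder is renamed to a variable not
  -- occurring in any ρ y with y in its body, so nothing is captured.
  subst* : (Var → Preterm) → Preterm → Preterm
  subst* ρ (PVr x)   = ρ x
  subst* ρ (PAp p q) = PAp (subst* ρ p) (subst* ρ q)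
  subst* ρ (PLm x p) = PLm z (subst* (ρ [ x ≔ PVr z ]) p)
    where z = fresh (concatMap (vars ∘ ρ) (vars p))

  subst₁ : Preterm → Preterm → Var → Preterm
  subst₁ t s x = subst* (PVr [ x ≔ s ]) t

  FV⊆vars : ∀ p {v} → v ∈ FVᵖ p → v List.∈ vars p
  FV⊆vars (PVr x)   refl = here refl
  FV⊆vars (PAp p q) (inj₁ m) = ∈-++⁺ˡ (FV⊆vars p m)
  FV⊆vars (PAp p q) (inj₂ m) = ∈-++⁺ʳ (vars p) (FV⊆vars q m)
  FV⊆vars (PLm x p) (m , _) = there (FV⊆vars p m)

  FV-act : ∀ {σ} → Inj σ → ∀ p {v} → v ∈ FVᵖ p → σ v ∈ FVᵖ (act σ p)
  FV-act i (PVr x)   refl = refl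
  FV-act i (PAp p q) (inj₁ m) = inj₁ (FV-act i p m)
  FV-act i (PAp p q) (inj₂ m) = inj₂ (FV-act i q m)
  FV-act i (PLm x p) (m , n) = FV-act i p m , n ∘ i

  FV-swap⁻ : ∀ x y p {v} → v ∈ FVᵖ (act (swap x y) p) → swap x y v ∈ FVᵖ p
  FV-swap⁻ x y p {v} m = subst (λ q → swap x y v ∈ FVᵖ q) back (FV-act (swap-inj x y) (act (swap x y) p) {v} m)
    where
    back : act (swap x y) (act (swap x y) p) ≡ p
    back = trans (act-∘ _ _ p) (trans (act-ext p λ {v} _ → swap-invol x y v) (act-id p))

  -- If z does not occur in q, then no free variable of q [ y ∧ z ] is y.
  FV-swap-≢ : ∀ {y z q} → ¬ (z List.∈ vars q) → ∀ {v} → v ∈ FVᵖ (act (swap y z) q) → y ≢ v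
  FV-swap-≢ {y} {z} {q} n m refl =
    n (FV⊆vars q (subst (_∈ FVᵖ q) (swapˡ y z) (FV-swap⁻ y z q m)))

  FV-α : ∀ {p q} → p =α q → FVᵖ p ⊆ FVᵖ q
  FV-α =PVr m = m
  FV-α (=PAp d e) (inj₁ m) = inj₁ (FV-α d m)
  FV-α (=PAp d e) (inj₂ m) = inj₂ (FV-α e m)
  FV-α (=PLm {x} {y} {p} {q} z n n′ d) {v} (m , x≢v) = v∈q , y≢v
    where
    v≢z : v ≢ z
    v≢z = ≢-of-∉ (FV⊆vars p m) (n ∘ there)

    v∈ : v ∈ FVᵖ (act (swap y z) q)
    v∈ = FV-α d (subst (_∈ FVᵖ (act (swap x z) p)) (swap-≢ x z (x≢v ∘ sym) v≢z)
                   (FV-act (swap-inj x z) p m))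

    y≢v : y ≢ v
    y≢v = FV-swap-≢ {q = q} (n′ ∘ there) v∈

    v∈q : v ∈ FVᵖ q
    v∈q = subst (_∈ FVᵖ q) (swap-≢ y z (y≢v ∘ sym) v≢z) (FV-swap⁻ y z q v∈)

  ≔-≡ : ∀ ρ x s → (ρ [ x ≔ s ]) x ≡ s
  ≔-≡ ρ x s with x ≟ x
  ... | yes _ = refl
  ... | no ¬p = contradiction refl ¬p

  ≔-≢ : ∀ ρ {x} s {v} → v ≢ x → (ρ [ x ≔ s ]) v ≡ ρ v
  ≔-≢ ρ {x} s {v} p with v ≟ x
  ... | yes e = contradiction e p
  ... | no _ = refl

  ∉-concatMap : ∀ {f : Var → List Var} {xs w v} → ¬ (w List.∈ concatMap f xs) → v List.∈ xs → ¬ (w List.∈ f v)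
  ∉-concatMap {f} {xs} n m k = n (∈-concatMap⁺ f {xs = xs} (lose m k))

  act-swap-act : ∀ {a w} σ → Inj σ → ∀ p → ¬ (a List.∈ vars p) → ¬ (w List.∈ vars (act σ p)) →
                 act (swap (σ a) w ∘ σ) p ≡ act σ p
  act-swap-act σ i p a∉ w∉ =
    trans (sym (act-∘ _ _ p)) (act-swap-∉ (act σ p) (∉-vars-act i p a∉) w∉)

  -- Both sides of the hypothesis, and of the conclusion, are a substitution
  -- between two permutations.
  subst*-cong : ∀ p {τ τ′ π π′} → Inj τ → Inj τ′ → Inj π → Inj π′ → ∀ ρ ρ′ →
    (∀ {v} → v ∈ FVᵖ p → act π (ρ (τ v)) =α act π′ (ρ′ (τ′ v))) →
    act π (subst* ρ (act τ p)) =α act π′ (subst* ρ′ (act τ′ p))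
  subst*-cong (PVr x)   iτ iτ′ iπ iπ′ ρ ρ′ h = h refl
  subst*-cong (PAp p q) iτ iτ′ iπ iπ′ ρ ρ′ h =
    =PAp (subst*-cong p iτ iτ′ iπ iπ′ ρ ρ′ (h ∘ inj₁)) (subst*-cong q iτ iτ′ iπ iπ′ ρ ρ′ (h ∘ inj₂))
  subst*-cong (PLm x p) {τ} {τ′} {π} {π′} iτ iτ′ iπ iπ′ ρ ρ′ h =
    =PLm w w∉₁ w∉₂ (subst₂ _=α_ (sym (act-∘ _ _ _)) (sym (act-∘ _ _ _))
      (subst*-cong p iτ iτ′ (iπ ∘ swap-inj _ w) (iπ′ ∘ swap-inj _ w) _ _ h′))
    where
    l = concatMap (vars ∘ ρ) (vars (act τ p))
    l′ = concatMap (vars ∘ ρ′) (vars (act τ′ p))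
    a = fresh l
    a′ = fresh l′
    l₁ = vars (act π (subst* ρ (act τ (PLm x p))))
    l₂ = vars (act π′ (subst* ρ′ (act τ′ (PLm x p))))
    l₃ = concatMap (λ v → vars (act π (ρ (τ v)))) (vars p)
    l₄ = concatMap (λ v → vars (act π′ (ρ′ (τ′ v)))) (vars p)
    w = fresh (l₁ ++ l₂ ++ l₃ ++ l₄)
    w∉ = fresh-∉ (l₁ ++ l₂ ++ l₃ ++ l₄)
    w∉₁ = ∉-++ˡ w∉
    w∉₂ = ∉-++ˡ (∉-++ʳ l₁ w∉)
    w∉₃ = ∉-++ˡ (∉-++ʳ l₂ (∉-++ʳ l₁ w∉))
    w∉₄ = ∉-++ʳ l₃ (∉-++ʳ l₂ (∉-++ʳ l₁ w∉))

    at-x : ∀ π (τ : Var → Var) ρ a → act (swap (π a) w ∘ π) ((ρ [ τ x ≔ PVr a ]) (τ x)) ≡ PVr w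
    at-x π τ ρ a = trans (cong (act _) (≔-≡ ρ (τ x) _)) (cong PVr (swapˡ _ w))

    h′ : ∀ {v} → v ∈ FVᵖ p →
         act (swap (π a) w ∘ π) ((ρ [ τ x ≔ PVr a ]) (τ v)) =α
         act (swap (π′ a′) w ∘ π′) ((ρ′ [ τ′ x ≔ PVr a′ ]) (τ′ v))
    h′ {v} m with v ≟ x
    ... | yes refl = α-reflexive (trans (at-x π τ ρ a) (sym (at-x π′ τ′ ρ′ a′)))
    ... | no v≢x = subst₂ _=α_
      (sym (trans (cong (act _) (≔-≢ ρ _ (v≢x ∘ iτ)))
        (act-swap-act π iπ _
          (∉-concatMap {vars ∘ ρ} (fresh-∉ l) (∈-vars-act⁺ τ p (FV⊆vars p m)))
          (∉-concatMap {λ v → vars (act π (ρ (τ v)))} w∉₃ (FV⊆vars p m)))))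
      (sym (trans (cong (act _) (≔-≢ ρ′ _ (v≢x ∘ iτ′)))
        (act-swap-act π′ iπ′ _
          (∉-concatMap {vars ∘ ρ′} (fresh-∉ l′) (∈-vars-act⁺ τ′ p (FV⊆vars p m)))
          (∉-concatMap {λ v → vars (act π′ (ρ′ (τ′ v)))} w∉₄ (FV⊆vars p m)))))
      (h (m , v≢x ∘ sym))

  subst*-shift : ∀ p {π} → Inj π → ∀ x z ρ →
    act π (subst* ρ p) =α act π (subst* (ρ ∘ swap x z) (act (swap x z) p))
  subst*-shift p {π} i x z ρ =
    subst (λ q → act π (subst* ρ q) =α act π (subst* (ρ ∘ swap x z) (act (swap x z) p))) (act-id p)
      (subst*-cong p id (swap-inj x z) i i ρ (ρ ∘ swap x z)
        λ {v} _ → α-reflexive (cong (act π ∘ ρ) (sym (swap-invol x z v))))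

  subst*-α : ∀ {p q} → p =α q → ∀ {π π′} → Inj π → Inj π′ → ∀ ρ ρ′ →
    (∀ {v} → v ∈ FVᵖ p → act π (ρ v) =α act π′ (ρ′ v)) →
    act π (subst* ρ p) =α act π′ (subst* ρ′ q)
  subst*-α =PVr i i′ ρ ρ′ h = h refl
  subst*-α (=PAp d e) i i′ ρ ρ′ h =
    =PAp (subst*-α d i i′ ρ ρ′ (h ∘ inj₁)) (subst*-α e i i′ ρ ρ′ (h ∘ inj₂))
  subst*-α (=PLm {x} {y} {p} {q} z n n′ d) {π} {π′} i i′ ρ ρ′ h =
    =PLm w w∉₁ w∉₂ (subst₂ _=α_ (sym (act-∘ _ _ _)) (sym (act-∘ _ _ _))
      (α-trans (subst*-shift p iΠ x z _)
        (α-trans (subst*-α d iΠ iΠ′ _ _ h′) (α-sym (subst*-shift q iΠ′ y z _)))))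
    where
    l = concatMap (vars ∘ ρ) (vars p)
    l′ = concatMap (vars ∘ ρ′) (vars q)
    a = fresh l
    a′ = fresh l′
    l₁ = vars (act π (subst* ρ (PLm x p)))
    l₂ = vars (act π′ (subst* ρ′ (PLm y q)))
    l₃ = concatMap (vars ∘ act π ∘ ρ) (vars p)
    l₄ = concatMap (vars ∘ act π′ ∘ ρ′) (vars q)
    w = fresh (l₁ ++ l₂ ++ l₃ ++ l₄)
    w∉ = fresh-∉ (l₁ ++ l₂ ++ l₃ ++ l₄)
    w∉₁ = ∉-++ˡ w∉
    w∉₂ = ∉-++ˡ (∉-++ʳ l₁ w∉)
    w∉₃ = ∉-++ˡ (∉-++ʳ l₂ (∉-++ʳ l₁ w∉))
    w∉₄ = ∉-++ʳ l₃ (∉-++ʳ l₂ (∉-++ʳ l₁ w∉))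

    iΠ : Inj (swap (π a) w ∘ π)
    iΠ = i ∘ swap-inj (π a) w

    iΠ′ : Inj (swap (π′ a′) w ∘ π′)
    iΠ′ = i′ ∘ swap-inj (π′ a′) w

    at-z : ∀ π ρ a x → act (swap (π a) w ∘ π) ((ρ [ x ≔ PVr a ]) (swap x z z)) ≡ PVr w
    at-z π ρ a x = trans (cong (act _ ∘ (ρ [ x ≔ PVr a ])) (swapʳ x z))
      (trans (cong (act _) (≔-≡ ρ x _)) (cong PVr (swapˡ _ w)))

    other : ∀ {π} → Inj π → ∀ ρ {a x v} → v ≢ x → v ≢ z →
      ¬ (a List.∈ vars (ρ v)) → ¬ (w List.∈ vars (act π (ρ v))) →
      act π (ρ v) ≡ act (swap (π a) w ∘ π) ((ρ [ x ≔ PVr a ]) (swap x z v))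
    other {π} i ρ {a} {x} v≢x v≢z a∉ w∉ = sym (trans
      (cong (act _) (trans (cong (ρ [ x ≔ PVr a ]) (swap-≢ x z v≢x v≢z)) (≔-≢ ρ _ v≢x)))
      (act-swap-act π i _ a∉ w∉))

    h′ : ∀ {v} → v ∈ FVᵖ (act (swap x z) p) →
         act (swap (π a) w ∘ π) ((ρ [ x ≔ PVr a ]) (swap x z v)) =α
         act (swap (π′ a′) w ∘ π′) ((ρ′ [ y ≔ PVr a′ ]) (swap y z v))
    h′ {v} m = go (v ≟ z)
      where
      x≢v : x ≢ v
      x≢v = FV-swap-≢ {q = p} (n ∘ there) m
      y≢v : y ≢ v
      y≢v = FV-swap-≢ {q = q} (n′ ∘ there) (FV-α d m)
      v∈p : v ≢ z → v ∈ FVᵖ p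
      v∈p v≢z = subst (_∈ FVᵖ p) (swap-≢ x z (x≢v ∘ sym) v≢z) (FV-swap⁻ x z p m)
      v∈q : v ≢ z → v ∈ FVᵖ q
      v∈q v≢z = subst (_∈ FVᵖ q) (swap-≢ y z (y≢v ∘ sym) v≢z) (FV-swap⁻ y z q (FV-α d m))
      go : Dec (v ≡ z) →
           act (swap (π a) w ∘ π) ((ρ [ x ≔ PVr a ]) (swap x z v)) =α
           act (swap (π′ a′) w ∘ π′) ((ρ′ [ y ≔ PVr a′ ]) (swap y z v))
      go (yes refl) = α-reflexive (trans (at-z π ρ a x) (sym (at-z π′ ρ′ a′ y)))
      go (no v≢z) = subst₂ _=α_
        (other i ρ (x≢v ∘ sym) v≢z
          (∉-concatMap {vars ∘ ρ} (fresh-∉ l) (FV⊆vars p (v∈p v≢z)))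
          (∉-concatMap {vars ∘ act π ∘ ρ} w∉₃ (FV⊆vars p (v∈p v≢z))))
        (other i′ ρ′ (y≢v ∘ sym) v≢z
          (∉-concatMap {vars ∘ ρ′} (fresh-∉ l′) (FV⊆vars q (v∈q v≢z)))
          (∉-concatMap {vars ∘ act π′ ∘ ρ′} w∉₄ (FV⊆vars q (v∈q v≢z))))
        (h (v∈p v≢z , x≢v))

  subst₁-cong : ∀ {t t′ s s′} x → t =α t′ → s =α s′ → subst₁ t s x =α subst₁ t′ s′ x
  subst₁-cong {t} {t′} {s} {s′} x d e =
    subst₂ _=α_ (act-id _) (act-id _) (subst*-α d id id _ _ λ {v} _ → pointwise v)
    where
    pointwise : ∀ v → act id ((PVr [ x ≔ s ]) v) =α act id ((PVr [ x ≔ s′ ]) v)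
    pointwise v with v ≟ x
    ... | yes _ = α-act id e
    ... | no _ = =PVr

  ----------------------------------------------------------------------

  -- Sets are represented by setoids, so all operations have to respect _≈_
  -- (and equality of permutations, which is pointwise).  Freshness is an
  -- arbitrary, not necessarily decidable, relation: a Boolean-valued
  -- one is the same thing only classically.
  record Model (S : Signature) : Set (lsuc ℓ) where
    field
      setoid : Setoid ℓ ℓ
    open Setoid setoid public using (_≈_; isEquivalence) renaming (Carrier to M)
    infix 4 _#_
    infixl 20 _[_]ᵖ _[_∧_] _[_/_]ˢ _[_/_]ʳ
    field
      Vr      : ⦃ vr ∈ˢ S ⦄ → Var → M
      Ap      : ⦃ ap ∈ˢ S ⦄ → M → M → M
      Lm      : ⦃ lm ∈ˢ S ⦄ → Var → M → M
      _[_]ᵖ   : ⦃ pm ∈ˢ S ⦄ → M → Perm → M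
      _[_∧_]  : ⦃ sw ∈ˢ S ⦄ → M → Var → Var → M
      _[_/_]ˢ : ⦃ sb ∈ˢ S ⦄ → M → M → Var → M
      _[_/_]ʳ : ⦃ ren ∈ˢ S ⦄ → M → Var → Var → M
      FV      : ⦃ fv ∈ˢ S ⦄ → M → Pred Var ℓ
      _#_     : ⦃ fr ∈ˢ S ⦄ → Var → M → Set ℓ
      Ap-cong : ⦃ _ : ap ∈ˢ S ⦄ → ∀ {m m′ n n′} → m ≈ m′ → n ≈ n′ → Ap m n ≈ Ap m′ n′
      Lm-cong : ⦃ _ : lm ∈ˢ S ⦄ → ∀ x {m m′} → m ≈ m′ → Lm x m ≈ Lm x m′
      pm-cong : ⦃ _ : pm ∈ˢ S ⦄ → ∀ {m m′} σ τ → m ≈ m′ → (∀ x → ⟪ σ ⟫ x ≡ ⟪ τ ⟫ x) →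
                m [ σ ]ᵖ ≈ m′ [ τ ]ᵖ
      sw-cong : ⦃ _ : sw ∈ˢ S ⦄ → ∀ {m m′} x y → m ≈ m′ → m [ x ∧ y ] ≈ m′ [ x ∧ y ]
      sb-cong : ⦃ _ : sb ∈ˢ S ⦄ → ∀ {m m′ n n′} x → m ≈ m′ → n ≈ n′ → m [ n / x ]ˢ ≈ m′ [ n′ / x ]ˢ
      ren-cong : ⦃ _ : ren ∈ˢ S ⦄ → ∀ {m m′} y x → m ≈ m′ → m [ y / x ]ʳ ≈ m′ [ y / x ]ʳ
      FV-resp : ⦃ _ : fv ∈ˢ S ⦄ → ∀ {m m′} → m ≈ m′ → FV m ⊆ FV m′
      #-resp  : ⦃ _ : fr ∈ˢ S ⦄ → ∀ {x m m′} → m ≈ m′ → x # m → x # m′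

  record Morphism {S : Signature} (𝓜 𝓝 : Model S) : Set ℓ where
    private
      module M = Model 𝓜
      module N = Model 𝓝
    field
      g      : M.M → N.M
      g-cong : ∀ {m n} → m M.≈ n → g m N.≈ g n
      g-Vr   : ⦃ _ : vr ∈ˢ S ⦄ → ∀ x → g (M.Vr x) N.≈ N.Vr x
      g-Ap   : ⦃ _ : ap ∈ˢ S ⦄ → ∀ m n → g (M.Ap m n) N.≈ N.Ap (g m) (g n)
      g-Lm   : ⦃ _ : lm ∈ˢ S ⦄ → ∀ x m → g (M.Lm x m) N.≈ N.Lm x (g m)
      g-pm   : ⦃ _ : pm ∈ˢ S ⦄ → ∀ m σ → g (m M.[ σ ]ᵖ) N.≈ (g m) N.[ σ ]ᵖ
      g-sw   : ⦃ _ : sw ∈ˢ S ⦄ → ∀ m x y → g (m M.[ x ∧ y ]) N.≈ (g m) N.[ x ∧ y ]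
      g-sb   : ⦃ _ : sb ∈ˢ S ⦄ → ∀ m n x → g (m M.[ n / x ]ˢ) N.≈ (g m) N.[ g n / x ]ˢ
      g-ren  : ⦃ _ : ren ∈ˢ S ⦄ → ∀ m y x → g (m M.[ y / x ]ʳ) N.≈ (g m) N.[ y / x ]ʳ
      g-FV   : ⦃ _ : fv ∈ˢ S ⦄ → ∀ m → N.FV (g m) ⊆ M.FV m
      g-#    : ⦃ _ : fr ∈ˢ S ⦄ → ∀ x m → x M.# m → x N.# g m

  Models : Signature → Category (lsuc ℓ) ℓ ℓ
  Models S = record
    { Obj = Model S
    ; Hom = Morphism
    ; _≈_ = λ {𝓜} {𝓝} f f′ → ∀ m → Model._≈_ 𝓝 (g f m) (g f′ m)
    ; equiv = λ {_} {𝓝} → record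
      { refl  = λ m → Setoid.refl (Model.setoid 𝓝)
      ; sym   = λ e m → Setoid.sym (Model.setoid 𝓝) (e m)
      ; trans = λ e e′ m → Setoid.trans (Model.setoid 𝓝) (e m) (e′ m)
      }
    ; idᶜ = λ {𝓜} → let ≈-refl = Setoid.refl (Model.setoid 𝓜) in record
      { g = id ; g-cong = id
      ; g-Vr = λ _ → ≈-refl ; g-Ap = λ _ _ → ≈-refl ; g-Lm = λ _ _ → ≈-refl
      ; g-pm = λ _ _ → ≈-refl ; g-sw = λ _ _ _ → ≈-refl ; g-sb = λ _ _ _ → ≈-refl
      ; g-ren = λ _ _ _ → ≈-refl ; g-FV = λ _ → id ; g-# = λ _ _ → id
      }
    ; _∘ᶜ_ = λ {_} {_} {𝓟} f f′ → let ≈-trans = Setoid.trans (Model.setoid 𝓟) in record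
      { g      = g f ∘ g f′
      ; g-cong = g-cong f ∘ g-cong f′
      ; g-Vr   = λ x → ≈-trans (g-cong f (g-Vr f′ x)) (g-Vr f x)
      ; g-Ap   = λ m n → ≈-trans (g-cong f (g-Ap f′ m n)) (g-Ap f _ _)
      ; g-Lm   = λ x m → ≈-trans (g-cong f (g-Lm f′ x m)) (g-Lm f _ _)
      ; g-pm   = λ m σ → ≈-trans (g-cong f (g-pm f′ m σ)) (g-pm f _ _)
      ; g-sw   = λ m x y → ≈-trans (g-cong f (g-sw f′ m x y)) (g-sw f _ _ _)
      ; g-sb   = λ m n x → ≈-trans (g-cong f (g-sb f′ m n x)) (g-sb f _ _ _)
      ; g-ren  = λ m y x → ≈-trans (g-cong f (g-ren f′ m y x)) (g-ren f _ _ _)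
      ; g-FV   = λ m → g-FV f′ m ∘ g-FV f (g f′ m)
      ; g-#    = λ x m → g-# f x (g f′ m) ∘ g-# f′ x m
      }
    ; ∘-resp-≈ = λ {_} {_} {𝓟} {f} {_} {_} {h′} e e′ m →
        Setoid.trans (Model.setoid 𝓟) (g-cong f (e′ m)) (e (g h′ m))
    ; identityˡ = λ {_} {𝓝} f m → Setoid.refl (Model.setoid 𝓝)
    ; identityʳ = λ {_} {𝓝} f m → Setoid.refl (Model.setoid 𝓝)
    ; assoc = λ {_} {_} {_} {𝓠} f f′ f″ m → Setoid.refl (Model.setoid 𝓠)
    }
    where open Morphism

  reduct : ∀ {S S′} → S ⊆ˢ S′ → Model S′ → Model S
  reduct inc 𝓜 = record
    { setoid = M.setoid
    ; Vr = λ ⦃ p ⦄ → M.Vr ⦃ inc p ⦄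
    ; Ap = λ ⦃ p ⦄ → M.Ap ⦃ inc p ⦄
    ; Lm = λ ⦃ p ⦄ → M.Lm ⦃ inc p ⦄
    ; _[_]ᵖ = λ ⦃ p ⦄ → M._[_]ᵖ ⦃ inc p ⦄
    ; _[_∧_] = λ ⦃ p ⦄ → M._[_∧_] ⦃ inc p ⦄
    ; _[_/_]ˢ = λ ⦃ p ⦄ → M._[_/_]ˢ ⦃ inc p ⦄
    ; _[_/_]ʳ = λ ⦃ p ⦄ → M._[_/_]ʳ ⦃ inc p ⦄
    ; FV = λ ⦃ p ⦄ → M.FV ⦃ inc p ⦄
    ; _#_ = λ ⦃ p ⦄ → M._#_ ⦃ inc p ⦄
    ; Ap-cong = λ ⦃ p ⦄ → M.Ap-cong ⦃ inc p ⦄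
    ; Lm-cong = λ ⦃ p ⦄ → M.Lm-cong ⦃ inc p ⦄
    ; pm-cong = λ ⦃ p ⦄ → M.pm-cong ⦃ inc p ⦄
    ; sw-cong = λ ⦃ p ⦄ → M.sw-cong ⦃ inc p ⦄
    ; sb-cong = λ ⦃ p ⦄ → M.sb-cong ⦃ inc p ⦄
    ; ren-cong = λ ⦃ p ⦄ → M.ren-cong ⦃ inc p ⦄
    ; FV-resp = λ ⦃ p ⦄ → M.FV-resp ⦃ inc p ⦄
    ; #-resp = λ ⦃ p ⦄ → M.#-resp ⦃ inc p ⦄
    }
    where module M = Model 𝓜

  reductFunctor : ∀ {S S′} → S ⊆ˢ S′ → Functor (Models S′) (Models S)
  reductFunctor inc = record
    { F₀ = reduct inc
    ; F₁ = λ f → record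
      { g = g f
      ; g-cong = g-cong f
      ; g-Vr = λ ⦃ p ⦄ → g-Vr f ⦃ inc p ⦄
      ; g-Ap = λ ⦃ p ⦄ → g-Ap f ⦃ inc p ⦄
      ; g-Lm = λ ⦃ p ⦄ → g-Lm f ⦃ inc p ⦄
      ; g-pm = λ ⦃ p ⦄ → g-pm f ⦃ inc p ⦄
      ; g-sw = λ ⦃ p ⦄ → g-sw f ⦃ inc p ⦄
      ; g-sb = λ ⦃ p ⦄ → g-sb f ⦃ inc p ⦄
      ; g-ren = λ ⦃ p ⦄ → g-ren f ⦃ inc p ⦄
      ; g-FV = λ ⦃ p ⦄ → g-FV f ⦃ inc p ⦄
      ; g-# = λ ⦃ p ⦄ → g-# f ⦃ inc p ⦄
      }
    ; F-resp-≈ = id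
    ; F-id = λ {𝓜} m → Setoid.refl (Model.setoid 𝓜)
    ; F-∘ = λ {_} {_} {𝓟} f f′ m → Setoid.refl (Model.setoid 𝓟)
    }
    where open Morphism

  Tr : ∀ S → Model S
  Tr S = record
    { setoid = Term
    ; Vr = PVr
    ; Ap = PAp
    ; Lm = PLm
    ; _[_]ᵖ = λ t σ → act ⟪ σ ⟫ t
    ; _[_∧_] = λ t x y → act (swap x y) t
    ; _[_/_]ˢ = subst₁
    ; _[_/_]ʳ = λ t y x → subst₁ t (PVr y) x
    ; FV = FVᵖ
    ; _#_ = λ x t → x ∉ FVᵖ t
    ; Ap-cong = =PAp
    ; Lm-cong = λ x → α-lm
    ; pm-cong = λ {m} {m′} σ τ d e →
        α-trans (α-act (perm-inj σ) d) (α-reflexive (act-ext m′ λ {v} _ → e v))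
    ; sw-cong = λ x y → α-act (swap-inj x y)
    ; sb-cong = subst₁-cong
    ; ren-cong = λ y x d → subst₁-cong x d =PVr
    ; FV-resp = FV-α
    ; #-resp = λ d n m → n (FV-α (α-sym d) m)
    }

  ----------------------------------------------------------------------

  ⟦_⟧ : (P : Property) → Model (symbols P) → Set ℓ

  ⟦ SwVr ⟧ 𝓜 = ∀ x z₁ z₂ → Vr x [ z₁ ∧ z₂ ] ≈ Vr (swap z₁ z₂ x)
    where open Model 𝓜
  ⟦ SwAp ⟧ 𝓜 = ∀ m₁ m₂ z₁ z₂ → Ap m₁ m₂ [ z₁ ∧ z₂ ] ≈ Ap (m₁ [ z₁ ∧ z₂ ]) (m₂ [ z₁ ∧ z₂ ])
    where open Model 𝓜
  ⟦ SwLm ⟧ 𝓜 = ∀ x m z₁ z₂ → Lm x m [ z₁ ∧ z₂ ] ≈ Lm (swap z₁ z₂ x) (m [ z₁ ∧ z₂ ])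
    where open Model 𝓜
  ⟦ SwId ⟧ 𝓜 = ∀ m z → m [ z ∧ z ] ≈ m
    where open Model 𝓜
  ⟦ SwIv ⟧ 𝓜 = ∀ m x y → m [ x ∧ y ] [ x ∧ y ] ≈ m
    where open Model 𝓜
  ⟦ SwCp ⟧ 𝓜 = ∀ m x y z₁ z₂ →
    m [ x ∧ y ] [ z₁ ∧ z₂ ] ≈ m [ z₁ ∧ z₂ ] [ swap z₁ z₂ x ∧ swap z₁ z₂ y ]
    where open Model 𝓜
  ⟦ SwFv ⟧ 𝓜 = ∀ m x y → x ∉ FV m → y ∉ FV m → m [ x ∧ y ] ≈ m
    where open Model 𝓜
  ⟦ SwCg ⟧ 𝓜 = ∀ x₁ x₂ z m₁ m₂ → z ≢ x₁ → z ≢ x₂ → z # m₁ → z # m₂ →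
    m₁ [ z ∧ x₁ ] ≈ m₂ [ z ∧ x₂ ] → Lm x₁ m₁ ≈ Lm x₂ m₂
    where open Model 𝓜
  ⟦ SwBvr ⟧ 𝓜 = ∀ x x′ m → x′ ≢ x → x′ # m → Lm x m ≈ Lm x′ (m [ x′ ∧ x ])
    where open Model 𝓜

  ⟦ PmVr ⟧ 𝓜 = ∀ x σ → Vr x [ σ ]ᵖ ≈ Vr (⟪ σ ⟫ x)
    where open Model 𝓜
  ⟦ PmAp ⟧ 𝓜 = ∀ m₁ m₂ σ → Ap m₁ m₂ [ σ ]ᵖ ≈ Ap (m₁ [ σ ]ᵖ) (m₂ [ σ ]ᵖ)
    where open Model 𝓜
  ⟦ PmLm ⟧ 𝓜 = ∀ x m σ → Lm x m [ σ ]ᵖ ≈ Lm (⟪ σ ⟫ x) (m [ σ ]ᵖ)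
    where open Model 𝓜
  ⟦ PmId ⟧ 𝓜 = ∀ m → m [ idᵖ ]ᵖ ≈ m
    where open Model 𝓜
  ⟦ PmCp ⟧ 𝓜 = ∀ m σ τ → m [ σ ]ᵖ [ τ ]ᵖ ≈ m [ τ ∘ᵖ σ ]ᵖ
    where open Model 𝓜
  ⟦ PmFv ⟧ 𝓜 = ∀ m σ → Empty (supp σ ∩ FV m) → m [ σ ]ᵖ ≈ m
    where open Model 𝓜

  ⟦ SbVr ⟧ 𝓜 = ∀ x n z → Vr x [ n / z ]ˢ ≈ (if does (x ≟ z) then n else Vr x)
    where open Model 𝓜
  ⟦ SbAp ⟧ 𝓜 = ∀ m₁ m₂ n z → Ap m₁ m₂ [ n / z ]ˢ ≈ Ap (m₁ [ n / z ]ˢ) (m₂ [ n / z ]ˢ)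
    where open Model 𝓜
  ⟦ SbLm ⟧ 𝓜 = ∀ x m n z → x ≢ z → x # n → Lm x m [ n / z ]ˢ ≈ Lm x (m [ n / z ]ˢ)
    where open Model 𝓜
  ⟦ SbBvr ⟧ 𝓜 = ∀ x x′ m → x′ ≢ x → x′ # m → Lm x m ≈ Lm x′ (m [ Vr x′ / x ]ˢ)
    where open Model 𝓜

  ⟦ RnVr ⟧ 𝓜 = ∀ x y z → Vr x [ y / z ]ʳ ≈ Vr (renVar y z x)
    where open Model 𝓜
  ⟦ RnAp ⟧ 𝓜 = ∀ m₁ m₂ y z → Ap m₁ m₂ [ y / z ]ʳ ≈ Ap (m₁ [ y / z ]ʳ) (m₂ [ y / z ]ʳ)
    where open Model 𝓜
  ⟦ RnLm₁ ⟧ 𝓜 = ∀ x m y z → x ≢ y → x ≢ z → Lm x m [ y / z ]ʳ ≈ Lm x (m [ y / z ]ʳ)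
    where open Model 𝓜
  ⟦ RnLm₂ ⟧ 𝓜 = ∀ x m z → Lm x m [ z / x ]ʳ ≈ Lm x m
    where open Model 𝓜
  ⟦ RnBvr ⟧ 𝓜 = ∀ x x′ m → x′ ≢ x → x′ # m → Lm x m ≈ Lm x′ (m [ x′ / x ]ʳ)
    where open Model 𝓜
  ⟦ RnBvr₂ ⟧ 𝓜 = ∀ x x′ y m → y ≢ x′ → Lm x (m [ y / x′ ]ʳ) ≈ Lm x′ (m [ y / x′ ]ʳ [ x′ / x ]ʳ)
    where open Model 𝓜
  ⟦ RnId ⟧ 𝓜 = ∀ m z → m [ z / z ]ʳ ≈ m
    where open Model 𝓜
  ⟦ RnIm ⟧ 𝓜 = ∀ m x₁ x₂ y → x₁ ≢ y → m [ x₁ / y ]ʳ [ x₂ / y ]ʳ ≈ m [ x₁ / y ]ʳ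
    where open Model 𝓜
  ⟦ RnCh ⟧ 𝓜 = ∀ m x₁ x₂ x₃ y → y ≢ x₂ →
    m [ y / x₂ ]ʳ [ x₂ / x₁ ]ʳ [ x₃ / x₂ ]ʳ ≈ m [ y / x₂ ]ʳ [ x₃ / x₁ ]ʳ
    where open Model 𝓜
  ⟦ RnCm ⟧ 𝓜 = ∀ m x₁ x₂ y₁ y₂ → x₂ ≢ y₁ → y₁ ≢ x₁ → x₁ ≢ y₂ →
    m [ x₂ / x₁ ]ʳ [ y₂ / y₁ ]ʳ ≈ m [ y₂ / y₁ ]ʳ [ x₂ / x₁ ]ʳ
    where open Model 𝓜

  ⟦ FrVr ⟧ 𝓜 = ∀ x z → z ≢ x → z # Vr x
    where open Model 𝓜
  ⟦ FrAp ⟧ 𝓜 = ∀ m₁ m₂ z → z # m₁ → z # m₂ → z # Ap m₁ m₂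
    where open Model 𝓜
  ⟦ FrLm ⟧ 𝓜 = ∀ x m z → z ≡ x ⊎ z # m → z # Lm x m
    where open Model 𝓜
  ⟦ FvVr ⟧ 𝓜 = ∀ x → FV (Vr x) ⊆ ｛ x ｝
    where open Model 𝓜
  ⟦ FvAp ⟧ 𝓜 = ∀ m₁ m₂ → FV (Ap m₁ m₂) ⊆ FV m₁ ∪ FV m₂
    where open Model 𝓜
  ⟦ FvLm ⟧ 𝓜 = ∀ x m → FV (Lm x m) ⊆ FV m ∖ ｛ x ｝
    where open Model 𝓜
  ⟦ FvDPm ⟧ 𝓜 = ∀ m → FV m ≐ (λ x → Infinite (λ y → ¬ (m [ transposition x y ]ᵖ ≈ m)))
    where open Model 𝓜
  ⟦ FvDSw ⟧ 𝓜 = ∀ m → FV m ≐ (λ x → Infinite (λ y → ¬ (m [ x ∧ y ] ≈ m)))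
    where open Model 𝓜
  ⟦ FCB ⟧ 𝓜 = ∃[ x ] (∀ m → x ∉ FV (Lm x m))
    where open Model 𝓜

  infix 4 _⊨_ _⊨*_

  _⊨_ : ∀ {S} → Model S → Property → Set ℓ
  _⊨_ {S} 𝓜 P = Σ[ inc ∈ symbols P ⊆ˢ S ] ⟦ P ⟧ (reduct {symbols P} {S} inc 𝓜)

  _⊨*_ : ∀ {S} → Model S → List Property → Set ℓ
  𝓜 ⊨* Ps = All (𝓜 ⊨_) Ps

  ----------------------------------------------------------------------

  ModelsOf : Signature → List Property → Category (lsuc ℓ) ℓ ℓ
  ModelsOf S Ps = FullSubcategory (Models S) (_⊨* Ps)

  forget : ∀ i → Functor (ModelsOf (Sig i) (Props i)) (Models Σctor)
  forget i = record
    { F₀ = F₀ ∘ proj₁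
    ; F₁ = F₁
    ; F-resp-≈ = λ {_} {_} {f} {f′} → F-resp-≈ {f = f} {f′}
    ; F-id = λ {A} → F-id {proj₁ A}
    ; F-∘ = F-∘
    }
    where open Functor (reductFunctor {Σctor} {Sig i} (Σctor⊆Sig i))

  r : ∀ i → Tr (Sig i) ⊨* Props i → Tuple (lsuc ℓ) ℓ ℓ (lsuc ℓ) ℓ ℓ
  r i sat = record
    { B = Models Σctor
    ; base = Tr Σctor
    ; C = ModelsOf (Sig i) (Props i)
    ; I = Tr (Sig i) , sat
    ; R = forget i
    }

{-# OPTIONS --safe #-}
module Submission where

-- A term has a unique interpretation in any model of the constructors, given
-- by structural recursion on preterms (eval).  Hence in each of the nine cases
-- there is at most one morphism out of the term model (eval-unique), and the
-- interpretation is one as soon as it is invariant under α-equivalence and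
-- preserves the remaining symbols (extend).
--
-- Invariance follows from a single fact, RenamesBinders: the interpretation of
-- an abstraction does not change when its bound variable x is replaced, by
-- swapping, with a variable z not occurring in it.  The axioms give this fact
-- as follows; where they speak of freshness, a variable that is not free in a
-- term is fresh for its interpretation (eval-#).
--  * Swapping: SwBvr and SwCg give it almost directly (bvr⇒renames,
--    cg⇒renames).  If swapping two fresh variables has no effect, then SwBvr
--    holds with freshness as the complement of FV (Free).
--  * Nominal freeness (Nominal): FCB says that for some x₀, every abstraction
--    over x₀ is fixed by swapping x₀ with all but finitely many w.  On
--    interpretations of terms, conjugation with the swapping of x and x₀ turns
--    this into the same for any x, and then w is swapped with z.  Excluded
--    middle turns "not infinite" into "finite" here.
--  * Permutations restrict to transpositions (Permuting), substitutions to
--    variables (Substitution); this leads back to swapping and to renaming.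
--  * Renaming (Renaming): by RnBvr it is enough that renaming x to a variable
--    z that does not occur in t acts on the interpretation of t like swapping
--    x and z; this is renames-to-fresh, by induction on t up to permutations.
--    Without a freshness symbol, z is taken to be fresh for m if renaming z
--    to some other variable fixes m, and then RnBvr₂, RnLm₂ and RnIm give
--    RnBvr and the freshness axioms (RenamingOnly).
--
-- The other symbols are preserved by induction on terms; for substitution and
-- renaming, bound variables may be assumed to avoid the variables involved
-- (α-induction).  Finally, terms satisfy every property on its own
-- (Tr-satisfies).

open import Axiom.ExcludedMiddle using (ExcludedMiddle)
open import Data.Bool.Base using (T; if_then_else_)
open import Data.Bool.Properties using (if-float; T-irrelevant)
open import Data.Fin.Base using (Fin)
open import Data.Fin.Patterns using (0F; 1F; 2F; 3F; 4F; 5F; 6F; 7F; 8F)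
open import Data.List.Base using (List; []; _∷_; _++_; concatMap)
open import Data.List.Membership.Propositional using (lose)
open import Data.List.Relation.Unary.All using ([]; _∷_; tabulate)
open import Data.List.Relation.Unary.Any using (here; there)
open import Data.List.Relation.Unary.Any.Properties using (any⁺)
open import Data.Nat.Base using (ℕ)
open import Data.Product.Base using (Σ-syntax; ∃-syntax; _×_; _,_; proj₁; proj₂)
open import Data.Sum.Base using (_⊎_; inj₁; inj₂; [_,_])
-- As an instance, tt proves that a closed signature contains a symbol.
open import Data.Unit.Base using (tt)
open import Function.Base using (_∘_; id)
open import Function.Bundles using (_↔_)
open import Level using (Level)
open import Relation.Binary.Bundles using (Setoid)
open import Relation.Binary.PropositionalEquality
  using (_≡_; _≢_; refl; sym; trans; cong; cong₂; subst; subst₂)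
open import Relation.Nullary using (¬_; Dec; yes; no; does; contradiction)
open import Relation.Nullary.Decidable using (decidable-stable)
open import Relation.Unary using (Pred; _∈_; _∉_; _⊆_)
open import Defs

import Data.List.Membership.Propositional as List
import Relation.Binary.Reasoning.Setoid as SetoidReasoning

------------------------------------------------------------------------
-- Variables and lists of variables

module Terms {ℓ : Level} (Var : Set ℓ) (enum : Var ↔ ℕ) where

  open Lambda Var enum

  swap-comm : ∀ x y v → swap x y v ≡ swap y x v
  swap-comm x y v with swapView x y v
  ... | is-x refl e = trans e (sym (swapʳ y x))
  ... | is-y refl e = trans e (sym (swapˡ y x))
  ... | is-z p q e  = trans e (sym (swap-≢ y x q p))

  swap-id : ∀ x v → swap x x v ≡ v
  swap-id x v with swapView x x v
  ... | is-x refl e = e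
  ... | is-y refl e = e
  ... | is-z _ _ e  = e

  renVar-≡ : ∀ y z → renVar y z z ≡ y
  renVar-≡ y z with z ≟ z
  ... | yes _ = refl
  ... | no ¬p = contradiction refl ¬p

  renVar-≢ : ∀ y {z x} → x ≢ z → renVar y z x ≡ x
  renVar-≢ y {z} {x} p with x ≟ z
  ... | yes e = contradiction e p
  ... | no _  = refl

  renVar-removes : ∀ {y z} x → y ≢ z → renVar y z x ≢ z
  renVar-removes {y} {z} x y≢z with x ≟ z
  ... | yes _ = y≢z
  ... | no p  = p

  renVar-chain : ∀ {x₁ x₂} x₃ {v} → v ≢ x₂ →
                 renVar x₃ x₂ (renVar x₂ x₁ v) ≡ renVar x₃ x₁ v
  renVar-chain {x₁} {x₂} x₃ {v} v≢x₂ with v ≟ x₁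
  ... | yes _ = renVar-≡ x₃ x₂
  ... | no _  = renVar-≢ x₃ v≢x₂

  renVar-comm : ∀ {x₁ x₂ y₁ y₂} v → x₂ ≢ y₁ → y₁ ≢ x₁ → x₁ ≢ y₂ →
                renVar y₂ y₁ (renVar x₂ x₁ v) ≡ renVar x₂ x₁ (renVar y₂ y₁ v)
  renVar-comm {x₁} {x₂} {y₁} {y₂} v p q r with v ≟ x₁ | v ≟ y₁
  ... | yes refl | yes refl = contradiction refl q
  ... | yes refl | no _     = trans (renVar-≢ y₂ p) (sym (renVar-≡ x₂ x₁))
  ... | no _     | yes refl = trans (renVar-≡ y₂ y₁) (sym (renVar-≢ x₂ (r ∘ sym)))
  ... | no v≢x₁  | no v≢y₁  = trans (renVar-≢ y₂ v≢y₁) (sym (renVar-≢ x₂ v≢x₁))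

  ∉⇒≢ : ∀ {w v : Var} {xs} → ¬ (w List.∈ xs) → v List.∈ xs → w ≢ v
  ∉⇒≢ n m refl = n m

  ∉-vars-swap : ∀ {w x y} p → w ≢ x → w ≢ y → ¬ (w List.∈ vars p) →
                ¬ (w List.∈ vars (act (swap x y) p))
  ∉-vars-swap {w} {x} {y} p w≢x w≢y n =
    subst (λ v → ¬ (v List.∈ _)) (swap-≢ x y w≢x w≢y) (∉-vars-act (swap-inj x y) p n)

------------------------------------------------------------------------
-- Induction on terms up to renaming of bound variables

  -- Structural induction, except that the induction hypothesis for the body
  -- of an abstraction holds for all its images under injections.
  act-induction : ∀ {p} (P : Preterm → Set p) →
    (∀ x → P (PVr x)) →
    (∀ t u → P t → P u → P (PAp t u)) →
    (∀ x t → (∀ {σ} → Inj σ → P (act σ t)) → P (PLm x t)) →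
    ∀ t → P t
  act-induction P var app lam t = subst P (act-id t) (go t id)
    where
    go : ∀ t {σ} → Inj σ → P (act σ t)
    go (PVr x)   i = var _
    go (PAp t u) i = app _ _ (go t i) (go u i)
    go (PLm x t) {σ} i =
      lam _ _ λ {τ} j → subst P (sym (act-∘ τ σ t)) (go t (i ∘ j))

  rename-binder : ∀ {x z} t → ¬ (z List.∈ vars (PLm x t)) →
                  PLm x t =α PLm z (act (swap x z) t)
  rename-binder {x} {z} t z∉ =
    =PLm w (∉-++ˡ w∉) (∉-++ʳ (vars (PLm x t)) w∉)
      (α-reflexive (sym (act-swap-swap t (z∉ ∘ there) (∉-++ˡ w∉ ∘ there))))
    where
    l = vars (PLm x t) ++ vars (PLm z (act (swap x z) t))
    w = fresh l
    w∉ = fresh-∉ l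

  -- Induction on terms following the variable convention: bound variables may
  -- be assumed to avoid any given finite list.
  α-induction : ∀ {p} (P : Preterm → Set p) (avoid : List Var) →
    (∀ {t u} → t =α u → P t → P u) →
    (∀ x → P (PVr x)) →
    (∀ t u → P t → P u → P (PAp t u)) →
    (∀ x t → ¬ (x List.∈ avoid) → P t → P (PLm x t)) →
    ∀ t → P t
  α-induction P avoid resp var app lam = act-induction P var app λ x t ih →
    let l  = avoid ++ vars (PLm x t)
        w  = fresh l
        w∉ = fresh-∉ l
    in resp (α-sym (rename-binder t (∉-++ʳ avoid w∉)))
         (lam w _ (∉-++ˡ w∉) (ih (swap-inj x w)))

------------------------------------------------------------------------
-- Permutations of terms

  act-cong-α : ∀ {σ τ} → Inj σ → Inj τ → ∀ t →
               (∀ {v} → v ∈ FVᵖ t → σ v ≡ τ v) → act σ t =α act τ t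
  act-cong-α i j (PVr x)   h = α-reflexive (cong PVr (h refl))
  act-cong-α i j (PAp t u) h = =PAp (act-cong-α i j t (h ∘ inj₁)) (act-cong-α i j u (h ∘ inj₂))
  act-cong-α {σ} {τ} i j (PLm x t) h =
    =PLm w w∉₁ w∉₂ (subst₂ _=α_ (sym (act-∘ _ _ t)) (sym (act-∘ _ _ t))
      (act-cong-α (i ∘ swap-inj (σ x) w) (j ∘ swap-inj (τ x) w) t agree))
    where
    l₁ = vars (act σ (PLm x t))
    l₂ = vars (act τ (PLm x t))
    w = fresh (l₁ ++ l₂)
    w∉₁ = ∉-++ˡ (fresh-∉ (l₁ ++ l₂))
    w∉₂ = ∉-++ʳ l₁ (fresh-∉ (l₁ ++ l₂))

    unmoved : ∀ {σ} → Inj σ → ¬ (w List.∈ vars (act σ (PLm x t))) → ∀ {v} → v ∈ FVᵖ t →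
              v ≢ x → swap (σ x) w (σ v) ≡ σ v
    unmoved {σ} i w∉ m v≢x = swap-≢ (σ x) w (v≢x ∘ i)
      (∉⇒≢ w∉ (there (∈-vars-act⁺ σ t (FV⊆vars t m))) ∘ sym)

    agree : ∀ {v} → v ∈ FVᵖ t → swap (σ x) w (σ v) ≡ swap (τ x) w (τ v)
    agree {v} m with v ≟ x
    ... | yes refl = trans (swapˡ (σ v) w) (sym (swapˡ (τ v) w))
    ... | no v≢x   = trans (unmoved i w∉₁ m v≢x)
                       (trans (h (m , v≢x ∘ sym)) (sym (unmoved j w∉₂ m v≢x)))

  act-fixes : ∀ {σ} → Inj σ → ∀ t → (∀ {v} → v ∈ FVᵖ t → σ v ≡ v) → act σ t =α t
  act-fixes i t h = α-trans (act-cong-α i id t h) (α-reflexive (act-id t))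

  act-swap-fresh : ∀ {x y} t → x ∉ FVᵖ t → y ∉ FVᵖ t → act (swap x y) t =α t
  act-swap-fresh {x} {y} t x∉ y∉ = act-fixes (swap-inj x y) t λ m →
    swap-≢ x y (λ { refl → x∉ m }) (λ { refl → y∉ m })

  act-swap-comm : ∀ x y t → act (swap x y) t ≡ act (swap y x) t
  act-swap-comm x y t = act-ext t λ {v} _ → swap-comm x y v

  ∉-FV-Lm : ∀ {v x} t → v ≡ x ⊎ v ∉ FVᵖ t → v ∉ FVᵖ (PLm x t)
  ∉-FV-Lm t (inj₁ refl) (_ , x≢x) = x≢x refl
  ∉-FV-Lm t (inj₂ v∉)   (m , _)   = v∉ m

  -- Neither z nor x is free in the abstraction, so swapping them fixes it.
  swap-binder : ∀ {x z} t → z ∉ FVᵖ (PLm x t) → PLm x t =α PLm z (act (swap z x) t)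
  swap-binder {x} {z} t z∉ =
    subst (λ y → PLm x t =α PLm y (act (swap z x) t)) (swapʳ z x)
      (α-sym (act-swap-fresh (PLm x t) z∉ (∉-FV-Lm t (inj₁ refl))))

  swap-binder-cong : ∀ {x₁ x₂ z} t₁ t₂ → z ∉ FVᵖ t₁ → z ∉ FVᵖ t₂ →
    act (swap z x₁) t₁ =α act (swap z x₂) t₂ → PLm x₁ t₁ =α PLm x₂ t₂
  swap-binder-cong t₁ t₂ z∉₁ z∉₂ d =
    α-trans (swap-binder t₁ (∉-FV-Lm t₁ (inj₂ z∉₁)))
      (α-trans (α-lm d) (α-sym (swap-binder t₂ (∉-FV-Lm t₂ (inj₂ z∉₂)))))

  -- If x is free in t, then swapping it with any y that does not occur in t
  -- changes t; if not, only a y that occurs in t can do so (moved⊆vars).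
  FV⇒infinite-support : ∀ {x} t → x ∈ FVᵖ t → Infinite (λ y → ¬ (act (swap x y) t =α t))
  FV⇒infinite-support {x} t m (ys , all) =
    w∉₁ (all λ d → w∉₂ (FV⊆vars t (FV-α d
      (subst (_∈ FVᵖ (act (swap x w) t)) (swapˡ x w) (FV-act (swap-inj x w) t m)))))
    where
    w = fresh (ys ++ vars t)
    w∉₁ = ∉-++ˡ (fresh-∉ (ys ++ vars t))
    w∉₂ = ∉-++ʳ ys (fresh-∉ (ys ++ vars t))

  FV? : ∀ x t → Dec (x ∈ FVᵖ t)
  FV? x (PVr y) with y ≟ x
  ... | yes e = yes e
  ... | no n  = no n
  FV? x (PAp t u) with FV? x t | FV? x u
  ... | yes m | _     = yes (inj₁ m)
  ... | no _  | yes m = yes (inj₂ m)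
  ... | no n  | no n′ = no [ n , n′ ]
  FV? x (PLm y t) with FV? x t | y ≟ x
  ... | yes m | no n  = yes (m , n)
  ... | yes _ | yes e = no λ (_ , n) → n e
  ... | no n  | _     = no (n ∘ proj₁)

  moved⊆vars : ∀ {x y} t → x ∉ FVᵖ t → ¬ (act (swap x y) t =α t) → y List.∈ vars t
  moved⊆vars {x} {y} t x∉ ¬d with FV? y t
  ... | yes m = FV⊆vars t m
  ... | no y∉ = contradiction (act-swap-fresh t x∉ y∉) ¬d

  infinite-support⇒FV : ∀ {x} t → Infinite (λ y → ¬ (act (swap x y) t =α t)) → x ∈ FVᵖ t
  infinite-support⇒FV {x} t inf =
    decidable-stable (FV? x t) λ x∉ → inf (vars t , moved⊆vars t x∉)

------------------------------------------------------------------------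
-- Substitution in terms

  FV-subst*⁻ : ∀ t ρ {v} → v ∈ FVᵖ (subst* ρ t) → ∃[ u ] u ∈ FVᵖ t × v ∈ FVᵖ (ρ u)
  FV-subst*⁻ (PVr x)   ρ m = x , refl , m
  FV-subst*⁻ (PAp t t′) ρ (inj₁ m) = let u , u∈ , v∈ = FV-subst*⁻ t ρ m in u , inj₁ u∈ , v∈
  FV-subst*⁻ (PAp t t′) ρ (inj₂ m) = let u , u∈ , v∈ = FV-subst*⁻ t′ ρ m in u , inj₂ u∈ , v∈
  FV-subst*⁻ (PLm x t) ρ {v} (m , a≢v) with FV-subst*⁻ t _ m
  ... | u , u∈ , v∈ with u ≟ x
  ...   | yes _  = contradiction v∈ a≢v
  ...   | no u≢x = u , (u∈ , u≢x ∘ sym) , v∈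

  -- Substitution may keep the binder if that captures nothing.
  subst*-Lm : ∀ {x} t ρ → ρ x ≡ PVr x → (∀ {v} → v ∈ FVᵖ t → v ≢ x → x ∉ FVᵖ (ρ v)) →
              subst* ρ (PLm x t) =α PLm x (subst* ρ t)
  subst*-Lm {x} t ρ ρx x∉ρ =
    α-trans (swap-binder (subst* (ρ [ x ≔ PVr a ]) t) x∉)
      (α-lm (subst (act (swap x a) (subst* (ρ [ x ≔ PVr a ]) t) =α_) (act-id _)
        (subst*-α (α-refl t) (swap-inj x a) id _ _ pointwise)))
    where
    l = concatMap (vars ∘ ρ) (vars t)
    a = fresh l

    x∉ : x ∉ FVᵖ (PLm a (subst* (ρ [ x ≔ PVr a ]) t))
    x∉ (m , a≢x) with FV-subst*⁻ t _ m
    ... | u , u∈ , v∈ with u ≟ x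
    ...   | yes _  = a≢x v∈
    ...   | no u≢x = x∉ρ u∈ u≢x v∈

    pointwise : ∀ {v} → v ∈ FVᵖ t → act (swap x a) ((ρ [ x ≔ PVr a ]) v) =α act id (ρ v)
    pointwise {v} m = α-trans (lemma (v ≟ x)) (α-reflexive (sym (act-id _)))
      where
      lemma : Dec (v ≡ x) → act (swap x a) ((ρ [ x ≔ PVr a ]) v) =α ρ v
      lemma (yes refl) = α-reflexive (trans (cong (act _) (≔-≡ ρ x _))
        (trans (cong PVr (swapʳ x a)) (sym ρx)))
      lemma (no v≢x) = α-trans (α-reflexive (cong (act _) (≔-≢ ρ _ v≢x)))
        (act-swap-fresh (ρ v) (x∉ρ m v≢x)
          (∉-concatMap {vars ∘ ρ} (fresh-∉ l) (FV⊆vars t m) ∘ FV⊆vars (ρ v)))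

  subst*-id : ∀ t → subst* PVr t =α t
  subst*-id (PVr x)   = =PVr
  subst*-id (PAp t u) = =PAp (subst*-id t) (subst*-id u)
  subst*-id (PLm x t) = α-trans (subst*-Lm t PVr refl λ _ v≢x → v≢x) (α-lm (subst*-id t))

  -- A substitution of variables for variables that is injective is a
  -- permutation.
  subst*-act : ∀ {σ} → Inj σ → ∀ t ρ → (∀ {v} → v ∈ FVᵖ t → ρ v ≡ PVr (σ v)) →
               subst* ρ t =α act σ t
  subst*-act {σ} i t ρ h =
    α-trans (subst (_=α act σ (subst* PVr t)) (act-id _)
        (subst*-α (α-refl t) id i ρ PVr λ m → α-reflexive (trans (act-id _) (h m))))
      (α-act i (subst*-id t))

  subst₁-fresh : ∀ {x} t s → x ∉ FVᵖ t → subst₁ t s x =α t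
  subst₁-fresh t s x∉ = α-trans
    (subst*-act id t _ λ {v} m → ≔-≢ PVr s λ { refl → x∉ m })
    (α-reflexive (act-id t))

  ren-id : ∀ t x → subst₁ t (PVr x) x =α t
  ren-id t x = α-trans (subst*-act id t _ λ {v} _ → pointwise v) (α-reflexive (act-id t))
    where
    pointwise : ∀ v → (PVr [ x ≔ PVr x ]) v ≡ PVr v
    pointwise v with v ≟ x
    ... | yes refl = refl
    ... | no _     = refl

  ren-Vr : ∀ x y z → subst₁ (PVr x) (PVr y) z ≡ PVr (renVar y z x)
  ren-Vr x y z = sym (if-float PVr (does (x ≟ z)))

  subst₁-Lm : ∀ {x} t s {z} → x ≢ z → x ∉ FVᵖ s → subst₁ (PLm x t) s z =α PLm x (subst₁ t s z)
  subst₁-Lm {x} t s {z} x≢z x∉ = subst*-Lm t _ (≔-≢ PVr s x≢z) x∉ρ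
    where
    x∉ρ : ∀ {v} → v ∈ FVᵖ t → v ≢ x → x ∉ FVᵖ ((PVr [ z ≔ s ]) v)
    x∉ρ {v} _ v≢x with v ≟ z
    ... | yes _ = x∉
    ... | no _  = v≢x

  ren-Lm : ∀ {x y z} t → x ≢ y → x ≢ z → subst₁ (PLm x t) (PVr y) z =α PLm x (subst₁ t (PVr y) z)
  ren-Lm t x≢y x≢z = subst₁-Lm t _ x≢z (x≢y ∘ sym)

  ren-fresh : ∀ {x z} t → z ∉ FVᵖ t → subst₁ t (PVr z) x =α act (swap z x) t
  ren-fresh {x} {z} t z∉ = subst*-act (swap-inj z x) t _ pointwise
    where
    pointwise : ∀ {v} → v ∈ FVᵖ t → (PVr [ x ≔ PVr z ]) v ≡ PVr (swap z x v)
    pointwise {v} m with swapView z x v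
    ... | is-x refl _  = contradiction m z∉
    ... | is-y refl e  = trans (≔-≡ PVr v _) (cong PVr (sym e))
    ... | is-z _ v≢x e = trans (≔-≢ PVr _ v≢x) (cong PVr (sym e))

  ren-binder : ∀ {x z} t → z ∉ FVᵖ t → PLm x t =α PLm z (subst₁ t (PVr z) x)
  ren-binder t z∉ =
    α-trans (swap-binder t (∉-FV-Lm t (inj₂ z∉))) (α-lm (α-sym (ren-fresh t z∉)))

  ren-removes : ∀ {y z} t → y ≢ z → z ∉ FVᵖ (subst₁ t (PVr y) z)
  ren-removes {y} {z} t y≢z m with FV-subst*⁻ t _ m
  ... | u , _ , z∈ with u ≟ z
  ...   | yes _  = y≢z z∈
  ...   | no u≢z = u≢z z∈

  ren-binder₂ : ∀ x x′ {y} t → y ≢ x′ →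
    PLm x (subst₁ t (PVr y) x′) =α PLm x′ (subst₁ (subst₁ t (PVr y) x′) (PVr x′) x)
  ren-binder₂ x x′ t y≢x′ = ren-binder _ (ren-removes t y≢x′)

  infixl 20 _⟨_/_⟩

  -- Renaming, as substitution of a variable.
  _⟨_/_⟩ : Preterm → Var → Var → Preterm
  t ⟨ y / z ⟩ = subst₁ t (PVr y) z

  ren-under : ∀ {t w u y z} → t =α PLm w u → w ≢ y → w ≢ z → t ⟨ y / z ⟩ =α PLm w (u ⟨ y / z ⟩)
  ren-under {u = u} d w≢y w≢z = α-trans (subst₁-cong _ d =PVr) (ren-Lm u w≢y w≢z)

  ren-cong-α : ∀ {t u} y z → t =α u → t ⟨ y / z ⟩ =α u ⟨ y / z ⟩
  ren-cong-α y z d = subst₁-cong z d =PVr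

  ren-chain : ∀ {x₂ y} x₁ x₃ → y ≢ x₂ → ∀ t →
    t ⟨ y / x₂ ⟩ ⟨ x₂ / x₁ ⟩ ⟨ x₃ / x₂ ⟩ =α t ⟨ y / x₂ ⟩ ⟨ x₃ / x₁ ⟩
  ren-chain {x₂} {y} x₁ x₃ y≢x₂ = α-induction _ (y ∷ x₁ ∷ x₂ ∷ x₃ ∷ [])
    (λ d e → α-trans (α-sym (three d)) (α-trans e (two d)))
    (λ v → α-reflexive (trans
      (trans (cong (λ u → u ⟨ x₂ / x₁ ⟩ ⟨ x₃ / x₂ ⟩) (ren-Vr v y x₂))
        (trans (cong (_⟨ x₃ / x₂ ⟩) (ren-Vr _ x₂ x₁)) (ren-Vr _ x₃ x₂)))
      (trans (cong PVr (renVar-chain x₃ (renVar-removes v y≢x₂)))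
        (sym (trans (cong (_⟨ x₃ / x₁ ⟩) (ren-Vr v y x₂)) (ren-Vr _ x₃ x₁))))))
    (λ _ _ → =PAp)
    λ w t w∉ ih →
      let w≢y  = ∉⇒≢ w∉ (here refl)
          w≢x₁ = ∉⇒≢ w∉ (there (here refl))
          w≢x₂ = ∉⇒≢ w∉ (there (there (here refl)))
          w≢x₃ = ∉⇒≢ w∉ (there (there (there (here refl))))
          inner = ren-Lm t w≢y w≢x₂
      in α-trans (ren-under (ren-under inner w≢x₂ w≢x₁) w≢x₃ w≢x₂)
           (α-trans (α-lm ih) (α-sym (ren-under inner w≢x₃ w≢x₁)))
    where
    two : ∀ {t u} → t =α u → t ⟨ y / x₂ ⟩ ⟨ x₃ / x₁ ⟩ =α u ⟨ y / x₂ ⟩ ⟨ x₃ / x₁ ⟩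
    two d = ren-cong-α _ _ (ren-cong-α _ _ d)
    three : ∀ {t u} → t =α u →
      t ⟨ y / x₂ ⟩ ⟨ x₂ / x₁ ⟩ ⟨ x₃ / x₂ ⟩ =α u ⟨ y / x₂ ⟩ ⟨ x₂ / x₁ ⟩ ⟨ x₃ / x₂ ⟩
    three d = ren-cong-α _ _ (ren-cong-α _ _ (ren-cong-α _ _ d))

  ren-comm : ∀ {x₁ x₂ y₁ y₂} → x₂ ≢ y₁ → y₁ ≢ x₁ → x₁ ≢ y₂ → ∀ t →
    t ⟨ x₂ / x₁ ⟩ ⟨ y₂ / y₁ ⟩ =α t ⟨ y₂ / y₁ ⟩ ⟨ x₂ / x₁ ⟩
  ren-comm {x₁} {x₂} {y₁} {y₂} p q r = α-induction _ (x₁ ∷ x₂ ∷ y₁ ∷ y₂ ∷ [])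
    (λ d e → α-trans (α-sym (ren-cong-α _ _ (ren-cong-α _ _ d)))
      (α-trans e (ren-cong-α _ _ (ren-cong-α _ _ d))))
    (λ v → α-reflexive (trans
      (trans (cong (_⟨ y₂ / y₁ ⟩) (ren-Vr v x₂ x₁)) (ren-Vr _ y₂ y₁))
      (trans (cong PVr (renVar-comm v p q r))
        (sym (trans (cong (_⟨ x₂ / x₁ ⟩) (ren-Vr v y₂ y₁)) (ren-Vr _ x₂ x₁))))))
    (λ _ _ → =PAp)
    λ w t w∉ ih →
      let w≢x₁ = ∉⇒≢ w∉ (here refl)
          w≢x₂ = ∉⇒≢ w∉ (there (here refl))
          w≢y₁ = ∉⇒≢ w∉ (there (there (here refl)))
          w≢y₂ = ∉⇒≢ w∉ (there (there (there (here refl))))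
      in α-trans (ren-under (ren-Lm t w≢x₂ w≢x₁) w≢y₂ w≢y₁)
           (α-trans (α-lm ih) (α-sym (ren-under (ren-Lm t w≢y₂ w≢y₁) w≢x₂ w≢x₁)))

------------------------------------------------------------------------
-- Terms satisfy all the properties

  Tr-satisfies : ∀ P → ⟦ P ⟧ (Tr (symbols P))
  Tr-satisfies SwVr x z₁ z₂ = =PVr
  Tr-satisfies SwAp t u z₁ z₂ = α-refl _
  Tr-satisfies SwLm x t z₁ z₂ = α-refl _
  Tr-satisfies SwId t z = α-reflexive (trans (act-ext t λ {v} _ → swap-id z v) (act-id t))
  Tr-satisfies SwIv t x y = α-reflexive
    (trans (act-∘ _ _ t) (trans (act-ext t λ {v} _ → swap-invol x y v) (act-id t)))
  Tr-satisfies SwCp t x y z₁ z₂ = α-reflexive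
    (trans (act-∘ _ _ t)
      (trans (act-ext t λ {v} _ → swap-conj (swap-inj z₁ z₂) x y v) (sym (act-∘ _ _ t))))
  Tr-satisfies SwFv t x y = act-swap-fresh t
  Tr-satisfies SwCg x₁ x₂ z t₁ t₂ _ _ = swap-binder-cong t₁ t₂
  Tr-satisfies SwBvr x x′ t _ x′∉ = swap-binder t (∉-FV-Lm t (inj₂ x′∉))
  Tr-satisfies PmVr x σ = =PVr
  Tr-satisfies PmAp t u σ = α-refl _
  Tr-satisfies PmLm x t σ = α-refl _
  Tr-satisfies PmId t = α-reflexive (act-id t)
  Tr-satisfies PmCp t σ τ = α-reflexive (act-∘ _ _ t)
  Tr-satisfies PmFv t σ disjoint = act-fixes (perm-inj σ) t λ {v} m →
    decidable-stable (⟪ σ ⟫ v ≟ v) λ v∈supp → disjoint v (v∈supp , m)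
  Tr-satisfies SbVr x s z = α-refl _
  Tr-satisfies SbAp t u s z = α-refl _
  Tr-satisfies SbLm x t s z = subst₁-Lm t s
  Tr-satisfies SbBvr x x′ t _ = ren-binder t
  Tr-satisfies RnVr x y z = α-reflexive (ren-Vr x y z)
  Tr-satisfies RnAp t u y z = α-refl _
  Tr-satisfies RnLm₁ x t y z = ren-Lm t
  Tr-satisfies RnLm₂ x t z = subst₁-fresh (PLm x t) _ (∉-FV-Lm t (inj₁ refl))
  Tr-satisfies RnBvr x x′ t _ = ren-binder t
  Tr-satisfies RnBvr₂ x x′ y t = ren-binder₂ x x′ t
  Tr-satisfies RnId = ren-id
  Tr-satisfies RnIm t x₁ x₂ y x₁≢y = subst₁-fresh _ _ (ren-removes t x₁≢y)
  Tr-satisfies RnCh t x₁ x₂ x₃ y y≢x₂ = ren-chain x₁ x₃ y≢x₂ t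
  Tr-satisfies RnCm t x₁ x₂ y₁ y₂ p q r = ren-comm p q r t
  Tr-satisfies FrVr x z z≢x = z≢x ∘ sym
  Tr-satisfies FrAp t u z z∉ z∉′ = [ z∉ , z∉′ ]
  Tr-satisfies FrLm x t z = ∉-FV-Lm t
  Tr-satisfies FvVr x = id
  Tr-satisfies FvAp t u = id
  Tr-satisfies FvLm x t = id
  Tr-satisfies FvDPm t = FV⇒infinite-support t , infinite-support⇒FV t
  Tr-satisfies FvDSw t = FV⇒infinite-support t , infinite-support⇒FV t
  Tr-satisfies FCB = fresh [] , λ t → ∉-FV-Lm t (inj₁ refl)

  symbols⊆occurring : ∀ {P Ps} → P List.∈ Ps → symbols P ⊆ˢ occurring Ps
  symbols⊆occurring P∈ {s} s∈ = any⁺ (λ P → symbols P s) (lose P∈ s∈)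

  -- The reduct of a term model to fewer symbols is definitionally the term
  -- model over these, so Tr-satisfies applies as it stands.
  Tr⊨ : ∀ Ps → Tr (occurring Ps) ⊨* Ps
  Tr⊨ Ps = tabulate λ {P} P∈ → (λ {s} → symbols⊆occurring P∈ {s}) , Tr-satisfies P

------------------------------------------------------------------------
-- Interpretation of terms

  module Interpretation (𝓑 : Model Σctor) where

    open Model 𝓑 using (setoid; M; _≈_; Vr; Ap; Lm; Ap-cong; Lm-cong)
    open Setoid setoid using (reflexive)
      renaming (refl to ≈-refl; sym to ≈-sym; trans to ≈-trans)
    open SetoidReasoning setoid

    -- The interpretation of preterms, not yet known to respect α-equivalence.
    eval : Preterm → M
    eval (PVr x)   = Vr x
    eval (PAp t u) = Ap (eval t) (eval u)
    eval (PLm x t) = Lm x (eval t)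

    eval-≡ : ∀ {t u} → t ≡ u → eval t ≈ eval u
    eval-≡ e = reflexive (cong eval e)

    eval-unique : ∀ (f : Morphism (Tr Σctor) 𝓑) t → Morphism.g f t ≈ eval t
    eval-unique f (PVr x)   = Morphism.g-Vr f x
    eval-unique f (PAp t u) =
      ≈-trans (Morphism.g-Ap f t u) (Ap-cong (eval-unique f t) (eval-unique f u))
    eval-unique f (PLm x t) = ≈-trans (Morphism.g-Lm f x t) (Lm-cong x (eval-unique f t))

    -- The interpretation of an abstraction does not change when the bound
    -- variable is replaced with one not occurring in the term at all.
    RenamesBinders : Set ℓ
    RenamesBinders = ∀ {x z} t → ¬ (z List.∈ vars (PLm x t)) →
                     Lm x (eval t) ≈ Lm z (eval (act (swap x z) t))

    eval-cong : RenamesBinders → ∀ {t u} → t =α u → eval t ≈ eval u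
    eval-cong rename =PVr = ≈-refl
    eval-cong rename (=PAp d e) = Ap-cong (eval-cong rename d) (eval-cong rename e)
    eval-cong rename (=PLm {x} {y} {t} {u} z z∉t z∉u d) = begin
      Lm x (eval t)                    ≈⟨ rename t z∉t ⟩
      Lm z (eval (act (swap x z) t))   ≈⟨ Lm-cong z (eval-cong rename d) ⟩
      Lm z (eval (act (swap y z) u))   ≈⟨ rename u z∉u ⟨
      Lm y (eval u)                    ∎

    -- Freshness of a variable for an element is any relation satisfying the
    -- closure conditions for the constructors.
    module Freshness
      (_#_  : Var → M → Set ℓ)
      (frVr : ∀ x z → z ≢ x → z # Vr x)
      (frAp : ∀ m n z → z # m → z # n → z # Ap m n)
      (frLm : ∀ x m z → z ≡ x ⊎ z # m → z # Lm x m)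
      where

      eval-# : ∀ t {z} → z ∉ FVᵖ t → z # eval t
      eval-# (PVr x)   z∉ = frVr x _ (z∉ ∘ sym)
      eval-# (PAp t u) z∉ = frAp _ _ _ (eval-# t (z∉ ∘ inj₁)) (eval-# u (z∉ ∘ inj₂))
      eval-# (PLm x t) {z} z∉ with z ≟ x
      ... | yes e  = frLm x _ z (inj₁ e)
      ... | no z≢x = frLm x _ z (inj₂ (eval-# t λ m → z∉ (m , z≢x ∘ sym)))

    -- Freeness is treated as the complement of freshness.
    module Freeness
      (FV   : M → Pred Var ℓ)
      (fvVr : ∀ x {v} → v ∈ FV (Vr x) → x ≡ v)
      (fvAp : ∀ m n {v} → v ∈ FV (Ap m n) → v ∈ FV m ⊎ v ∈ FV n)
      (fvLm : ∀ x m {v} → v ∈ FV (Lm x m) → v ∈ FV m × ¬ (x ≡ v))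
      where

      frVr : ∀ x z → z ≢ x → z ∉ FV (Vr x)
      frVr x z z≢x m = z≢x (sym (fvVr x m))

      frAp : ∀ m n z → z ∉ FV m → z ∉ FV n → z ∉ FV (Ap m n)
      frAp m n z z∉m z∉n = [ z∉m , z∉n ] ∘ fvAp m n

      frLm : ∀ x m z → z ≡ x ⊎ z ∉ FV m → z ∉ FV (Lm x m)
      frLm x m z (inj₁ refl) p = proj₂ (fvLm x m p) refl
      frLm x m z (inj₂ z∉)   p = z∉ (proj₁ (fvLm x m p))

      open Freshness (λ z m → z ∉ FV m) frVr frAp frLm public

      eval-FV : ∀ t {v} → v ∈ FV (eval t) → v ∈ FVᵖ t
      eval-FV t {v} p = decidable-stable (FV? v t) λ v∉ → eval-# t v∉ p

------------------------------------------------------------------------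
-- Models with swapping

    module Swapping
      (_[_∧_]  : M → Var → Var → M)
      (sw-cong : ∀ {m n} x y → m ≈ n → m [ x ∧ y ] ≈ n [ x ∧ y ])
      (swVr : ∀ x z₁ z₂ → Vr x [ z₁ ∧ z₂ ] ≈ Vr (swap z₁ z₂ x))
      (swAp : ∀ m n z₁ z₂ → Ap m n [ z₁ ∧ z₂ ] ≈ Ap (m [ z₁ ∧ z₂ ]) (n [ z₁ ∧ z₂ ]))
      (swLm : ∀ x m z₁ z₂ → Lm x m [ z₁ ∧ z₂ ] ≈ Lm (swap z₁ z₂ x) (m [ z₁ ∧ z₂ ]))
      where

      eval-sw : ∀ t x y → eval (act (swap x y) t) ≈ eval t [ x ∧ y ]
      eval-sw (PVr z)   x y = ≈-sym (swVr z x y)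
      eval-sw (PAp t u) x y =
        ≈-trans (Ap-cong (eval-sw t x y) (eval-sw u x y)) (≈-sym (swAp _ _ x y))
      eval-sw (PLm z t) x y = ≈-trans (Lm-cong _ (eval-sw t x y)) (≈-sym (swLm z _ x y))

      module Fresh
        (_#_  : Var → M → Set ℓ)
        (frVr : ∀ x z → z ≢ x → z # Vr x)
        (frAp : ∀ m n z → z # m → z # n → z # Ap m n)
        (frLm : ∀ x m z → z ≡ x ⊎ z # m → z # Lm x m)
        where

        open Freshness _#_ frVr frAp frLm public

        bvr⇒renames : (∀ x z m → z ≢ x → z # m → Lm x m ≈ Lm z (m [ z ∧ x ])) → RenamesBinders
        bvr⇒renames swBvr {x} {z} t z∉ = begin
          Lm x (eval t)                    ≈⟨ swBvr x z _ (z∉ ∘ here)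
                                                (eval-# t (z∉ ∘ there ∘ FV⊆vars t)) ⟩
          Lm z (eval t [ z ∧ x ])          ≈⟨ Lm-cong z (eval-sw t z x) ⟨
          Lm z (eval (act (swap z x) t))   ≈⟨ Lm-cong z (eval-≡ (act-swap-comm z x t)) ⟩
          Lm z (eval (act (swap x z) t))   ∎

        cg⇒renames :
          (∀ x₁ x₂ z m₁ m₂ → z ≢ x₁ → z ≢ x₂ → z # m₁ → z # m₂ →
           m₁ [ z ∧ x₁ ] ≈ m₂ [ z ∧ x₂ ] → Lm x₁ m₁ ≈ Lm x₂ m₂) → RenamesBinders
        cg⇒renames swCg {x} {z} t z∉ =
          swCg x z w _ _ w≢x w≢z (eval-# t (w∉t ∘ FV⊆vars t)) (eval-# t′ (w∉t′ ∘ FV⊆vars t′))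
            (begin
              eval t [ w ∧ x ]           ≈⟨ eval-sw t w x ⟨
              eval (act (swap w x) t)    ≡⟨ cong eval (act-swap-comm w x t) ⟩
              eval (act (swap x w) t)    ≡⟨ cong eval (act-swap-swap t (z∉ ∘ there) w∉t) ⟨
              eval (act (swap z w) t′)   ≡⟨ cong eval (act-swap-comm z w t′) ⟩
              eval (act (swap w z) t′)   ≈⟨ eval-sw t′ w z ⟩
              eval t′ [ w ∧ z ]          ∎)
          where
          t′ = act (swap x z) t
          w = fresh (z ∷ vars (PLm x t))
          w∉ = fresh-∉ (z ∷ vars (PLm x t))
          w≢z = ∉⇒≢ w∉ (here refl)
          w≢x = ∉⇒≢ w∉ (there (here refl))
          w∉t = w∉ ∘ there ∘ there
          w∉t′ = ∉-vars-swap t w≢x w≢z w∉t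

      -- If swapping fresh variables has no effect, then swapping a bound
      -- variable with a fresh one has none on an abstraction.
      module Free
        (FV   : M → Pred Var ℓ)
        (swFv : ∀ m x y → x ∉ FV m → y ∉ FV m → m [ x ∧ y ] ≈ m)
        (fvVr : ∀ x {v} → v ∈ FV (Vr x) → x ≡ v)
        (fvAp : ∀ m n {v} → v ∈ FV (Ap m n) → v ∈ FV m ⊎ v ∈ FV n)
        (fvLm : ∀ x m {v} → v ∈ FV (Lm x m) → v ∈ FV m × ¬ (x ≡ v))
        where

        open Freeness FV fvVr fvAp fvLm public

        renames : RenamesBinders
        renames = Fresh.bvr⇒renames (λ z m → z ∉ FV m) frVr frAp frLm λ x z m _ z∉ → begin
          Lm x m                          ≈⟨ swFv (Lm x m) z x (frLm x m z (inj₂ z∉))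
                                               (frLm x m x (inj₁ refl)) ⟨
          Lm x m [ z ∧ x ]                ≈⟨ swLm x m z x ⟩
          Lm (swap z x x) (m [ z ∧ x ])   ≡⟨ cong (λ y → Lm y (m [ z ∧ x ])) (swapʳ z x) ⟩
          Lm z (m [ z ∧ x ])              ∎

      -- The nominal case, where freeness is defined from swapping.  The
      -- freshness condition for binders is assumed for one variable x₀ only;
      -- it carries over to the others by equivariance, but only for the
      -- interpretations of terms, which is enough.
      module Nominal
        (em   : ExcludedMiddle ℓ)
        (FV   : M → Pred Var ℓ)
        (fvD⁻ : ∀ m {x} → x ∈ FV m → Infinite (λ y → ¬ (m [ x ∧ y ] ≈ m)))
        (fvD⁺ : ∀ m {x} → Infinite (λ y → ¬ (m [ x ∧ y ] ≈ m)) → x ∈ FV m)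
        (fcb  : ∃[ x₀ ] (∀ m → x₀ ∉ FV (Lm x₀ m)))
        where

        eval-sw-cong : ∀ t u x y → eval t ≈ eval u →
                       eval (act (swap x y) t) ≈ eval (act (swap x y) u)
        eval-sw-cong t u x y e =
          ≈-trans (eval-sw t x y) (≈-trans (sw-cong x y e) (≈-sym (eval-sw u x y)))

        -- Outside any given list there is a variable whose swapping with the
        -- bound variable does not change the abstraction.
        Unbinds : Var → Set ℓ
        Unbinds x = ∀ t xs → ∃[ w ] ¬ (w List.∈ xs) ×
                    eval (act (swap x w) (PLm x t)) ≈ eval (PLm x t)

        unbinds₀ : Unbinds (proj₁ fcb)
        unbinds₀ t xs = w , ∉-++ˡ w∉ , ≈-trans (eval-sw (PLm x₀ t) x₀ w)
          (decidable-stable em (∉-++ʳ xs w∉ ∘ proj₂ moved-finite))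
          where
          x₀ = proj₁ fcb
          moved-finite : Finite (λ y → ¬ (Lm x₀ (eval t) [ x₀ ∧ y ] ≈ Lm x₀ (eval t)))
          moved-finite = decidable-stable em (proj₂ fcb (eval t) ∘ fvD⁺ _)
          w = fresh (xs ++ proj₁ moved-finite)
          w∉ = fresh-∉ (xs ++ proj₁ moved-finite)

        -- Conjugation with swap x x₀ carries the property of x₀ over to x.
        unbinds : ∀ x → Unbinds x
        unbinds x t xs = w , w∉ ∘ there ∘ there , (begin
          eval (act (swap x w) a)                  ≡⟨ cong eval conjugate ⟨
          eval (act π (act (swap x₀ w) (act π a))) ≈⟨ eval-sw-cong (act (swap x₀ w) (act π a)) (act π a) x x₀ e ⟩
          eval (act π (act π a))                   ≡⟨ cong eval involutive ⟩
          eval a                                   ∎)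
          where
          x₀ = proj₁ fcb
          π = swap x x₀
          a = PLm x t
          found = unbinds₀ (act π t) (x ∷ x₀ ∷ xs)
          w = proj₁ found
          w∉ = proj₁ (proj₂ found)

          e : eval (act (swap x₀ w) (act π a)) ≈ eval (act π a)
          e = subst (λ y → eval (act (swap x₀ w) (PLm y (act π t))) ≈ eval (PLm y (act π t)))
                (sym (swapˡ x x₀)) (proj₂ (proj₂ found))

          involutive : act π (act π a) ≡ a
          involutive = trans (act-∘ π π a)
            (trans (act-ext a λ {v} _ → swap-invol x x₀ v) (act-id a))

          pointwise : ∀ v → π (swap x₀ w (π v)) ≡ swap x w v
          pointwise v = trans (swap-conj (swap-inj x x₀) x₀ w (π v))
            (trans (cong₂ (λ y z → swap y z (π (π v))) (swapʳ x x₀)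
                      (swap-≢ x x₀ (∉⇒≢ w∉ (here refl)) (∉⇒≢ w∉ (there (here refl)))))
                   (cong (swap x w) (swap-invol x x₀ v)))

          conjugate : act π (act (swap x₀ w) (act π a)) ≡ act (swap x w) a
          conjugate = trans (cong (act π) (act-∘ _ _ a))
            (trans (act-∘ _ _ a) (act-ext a λ {v} _ → pointwise v))

        -- The variable w found by unbinds is replaced by the given z, since
        -- neither occurs in the abstraction.
        renames : RenamesBinders
        renames {x} {z} t z∉ with unbinds x t (vars (PLm x t))
        ... | w , w∉ , e = begin
          eval a                                      ≡⟨ cong eval (act-swap-∉ a w∉ z∉) ⟨
          eval (act (swap w z) a)                     ≈⟨ eval-sw-cong (act (swap x w) a) a w z e ⟨
          eval (act (swap w z) (act (swap x w) a))    ≡⟨ cong eval (act-swap-swap a w∉ z∉) ⟩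
          eval (act (swap x z) a)                     ≡⟨ cong (λ y → Lm y (eval (act (swap x z) t))) (swapˡ x z) ⟩
          Lm z (eval (act (swap x z) t))              ∎
          where a = PLm x t

        eval-FV : ∀ t {v} → v ∈ FV (eval t) → v ∈ FVᵖ t
        eval-FV t {v} m = decidable-stable (FV? v t) λ v∉ →
          fvD⁻ (eval t) m (vars t , λ {y} moved → moved⊆vars t v∉ λ d →
            moved (≈-trans (≈-sym (eval-sw t v y)) (eval-cong renames d)))

------------------------------------------------------------------------
-- Models with permutation

    module Permuting
      (_[_]    : M → Perm → M)
      (pm-cong : ∀ {m n} σ → m ≈ n → m [ σ ] ≈ n [ σ ])
      (pmVr : ∀ x σ → Vr x [ σ ] ≈ Vr (⟪ σ ⟫ x))
      (pmAp : ∀ m n σ → Ap m n [ σ ] ≈ Ap (m [ σ ]) (n [ σ ]))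
      (pmLm : ∀ x m σ → Lm x m [ σ ] ≈ Lm (⟪ σ ⟫ x) (m [ σ ]))
      where

      eval-pm : ∀ t σ → eval (act ⟪ σ ⟫ t) ≈ eval t [ σ ]
      eval-pm (PVr x)   σ = ≈-sym (pmVr x σ)
      eval-pm (PAp t u) σ = ≈-trans (Ap-cong (eval-pm t σ) (eval-pm u σ)) (≈-sym (pmAp _ _ σ))
      eval-pm (PLm x t) σ = ≈-trans (Lm-cong _ (eval-pm t σ)) (≈-sym (pmLm x _ σ))

      open Swapping (λ m x y → m [ transposition x y ])
        (λ x y → pm-cong (transposition x y))
        (λ x y z → pmVr x (transposition y z))
        (λ m n y z → pmAp m n (transposition y z))
        (λ x m y z → pmLm x m (transposition y z)) public

------------------------------------------------------------------------
-- Models with renaming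

    module Renaming
      (_[_/_]   : M → Var → Var → M)
      (ren-cong : ∀ {m n} y z → m ≈ n → m [ y / z ] ≈ n [ y / z ])
      (rnVr : ∀ x y z → Vr x [ y / z ] ≈ Vr (renVar y z x))
      (rnAp : ∀ m n y z → Ap m n [ y / z ] ≈ Ap (m [ y / z ]) (n [ y / z ]))
      (rnLm : ∀ x m y z → x ≢ y → x ≢ z → Lm x m [ y / z ] ≈ Lm x (m [ y / z ]))
      (_#_  : Var → M → Set ℓ)
      (rnBvr : ∀ x z m → z ≢ x → z # m → Lm x m ≈ Lm z (m [ z / x ]))
      (frVr : ∀ x z → z ≢ x → z # Vr x)
      (frAp : ∀ m n z → z # m → z # n → z # Ap m n)
      (frLm : ∀ x m z → z ≡ x ⊎ z # m → z # Lm x m)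
      where

      open Freshness _#_ frVr frAp frLm public

      -- Renaming to a variable not occurring in t acts on the interpretation of
      -- t like swapping.
      RenamesToFresh : Preterm → Set ℓ
      RenamesToFresh t = ∀ x z → z ≢ x → ¬ (z List.∈ vars t) →
                         eval t [ z / x ] ≈ eval (act (swap x z) t)

      renames-if : ∀ {x z} t → RenamesToFresh t → ¬ (z List.∈ vars (PLm x t)) →
                   Lm x (eval t) ≈ Lm z (eval (act (swap x z) t))
      renames-if {x} {z} t to-fresh z∉ =
        ≈-trans (rnBvr x z _ (z∉ ∘ here) (eval-# t (z∉ ∘ there ∘ FV⊆vars t)))
          (Lm-cong z (to-fresh x z (z∉ ∘ here) (z∉ ∘ there)))

      renames-to-fresh : ∀ t → RenamesToFresh t
      renames-to-fresh = act-induction RenamesToFresh var app lam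
        where
        var : ∀ v → RenamesToFresh (PVr v)
        var v x z z≢x z∉ = ≈-trans (rnVr v z x) (reflexive (cong Vr pointwise))
          where
          pointwise : renVar z x v ≡ swap x z v
          pointwise with swapView x z v
          ... | is-x refl e  = trans (renVar-≡ z x) (sym e)
          ... | is-y refl _  = contradiction (here refl) z∉
          ... | is-z v≢x _ e = trans (renVar-≢ z v≢x) (sym e)

        app : ∀ t u → RenamesToFresh t → RenamesToFresh u → RenamesToFresh (PAp t u)
        app t u ih ih′ x z z≢x z∉ = ≈-trans (rnAp _ _ z x)
          (Ap-cong (ih x z z≢x (∉-++ˡ z∉)) (ih′ x z z≢x (∉-++ʳ (vars t) z∉)))

        lam-≢ : ∀ {x y z} t → RenamesToFresh t → z ≢ x → ¬ (z List.∈ vars (PLm y t)) → y ≢ x →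
                Lm y (eval t) [ z / x ] ≈ Lm (swap x z y) (eval (act (swap x z) t))
        lam-≢ {x} {y} {z} t ih z≢x z∉ y≢x = begin
          Lm y (eval t) [ z / x ]                    ≈⟨ rnLm y _ z x y≢z y≢x ⟩
          Lm y (eval t [ z / x ])                    ≈⟨ Lm-cong y (ih x z z≢x (z∉ ∘ there)) ⟩
          Lm y (eval (act (swap x z) t))             ≡⟨ cong (λ v → Lm v _) (swap-≢ x z y≢x y≢z) ⟨
          Lm (swap x z y) (eval (act (swap x z) t))  ∎
          where y≢z = z∉ ∘ here ∘ sym

        -- Both sides equal Lm x (eval t).  For the left one, the binder x is
        -- renamed to some w distinct from x and z, which [ z / x ] can pass.
        lam-≡ : ∀ {x z} t → (∀ {σ} → Inj σ → RenamesToFresh (act σ t)) → RenamesToFresh t →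
                z ≢ x → ¬ (z List.∈ vars (PLm x t)) →
                Lm x (eval t) [ z / x ] ≈ Lm (swap x z x) (eval (act (swap x z) t))
        lam-≡ {x} {z} t ih ih₀ z≢x z∉ = begin
          Lm x (eval t) [ z / x ]            ≈⟨ ren-cong z x (renames-if t ih₀ w∉) ⟩
          Lm w (eval t′) [ z / x ]           ≈⟨ rnLm w _ z x w≢z w≢x ⟩
          Lm w (eval t′ [ z / x ])           ≈⟨ Lm-cong w (ih (swap-inj x w) x z z≢x z∉t′) ⟩
          Lm w (eval (act (swap x z) t′))    ≡⟨ cong (Lm w ∘ eval) (act-swap-∉ t′ x∉t′ z∉t′) ⟩
          Lm w (eval t′)                     ≈⟨ renames-if t ih₀ w∉ ⟨
          Lm x (eval t)                      ≈⟨ renames-if t ih₀ z∉ ⟩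
          Lm z (eval (act (swap x z) t))     ≡⟨ cong (λ v → Lm v (eval (act (swap x z) t))) (swapˡ x z) ⟨
          Lm (swap x z x) (eval (act (swap x z) t)) ∎
          where
          l = z ∷ vars (PLm x t)
          w = fresh l
          w∉ = fresh-∉ l ∘ there
          w≢z = ∉⇒≢ (fresh-∉ l) (here refl)
          w≢x = ∉⇒≢ w∉ (here refl)
          t′ = act (swap x w) t
          z∉t′ = ∉-vars-swap t z≢x (w≢z ∘ sym) (z∉ ∘ there)
          x∉t′ = subst (λ v → ¬ (v List.∈ vars t′)) (swapʳ x w)
                   (∉-vars-act (swap-inj x w) t (w∉ ∘ there))

        lam : ∀ y t → (∀ {σ} → Inj σ → RenamesToFresh (act σ t)) → RenamesToFresh (PLm y t)
        lam y t ih x z z≢x z∉ = by-cases (y ≟ x)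
          where
          ih₀ = subst RenamesToFresh (act-id t) (ih id)
          by-cases : Dec (y ≡ x) →
            Lm y (eval t) [ z / x ] ≈ Lm (swap x z y) (eval (act (swap x z) t))
          by-cases (yes refl) = lam-≡ t ih ih₀ z≢x z∉
          by-cases (no y≢x)   = lam-≢ t ih₀ z≢x z∉ y≢x

      renames : RenamesBinders
      renames t = renames-if t (renames-to-fresh t)

      eval-ren : ∀ t y z → eval (subst₁ t (PVr y) z) ≈ eval t [ y / z ]
      eval-ren t y z = α-induction (λ t → eval (subst₁ t (PVr y) z) ≈ eval t [ y / z ])
        (y ∷ z ∷ [])
        (λ d e → ≈-trans (≈-sym (eval-cong renames (subst₁-cong z d =PVr)))
          (≈-trans e (ren-cong y z (eval-cong renames d))))
        (λ x → ≈-trans (eval-≡ (ren-Vr x y z)) (≈-sym (rnVr x y z)))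
        (λ t u e e′ → ≈-trans (Ap-cong e e′) (≈-sym (rnAp _ _ y z)))
        (λ x t x∉ e → let x≢y = ∉⇒≢ x∉ (here refl) ; x≢z = ∉⇒≢ x∉ (there (here refl)) in
          ≈-trans (eval-cong renames (ren-Lm t x≢y x≢z))
            (≈-trans (Lm-cong x e) (≈-sym (rnLm x _ y z x≢y x≢z))))
        t

    -- Renaming alone determines a notion of freshness: z is fresh for m if
    -- renaming z to some other variable leaves m unchanged.
    module RenamingOnly
      (_[_/_]   : M → Var → Var → M)
      (ren-cong : ∀ {m n} y z → m ≈ n → m [ y / z ] ≈ n [ y / z ])
      (rnVr  : ∀ x y z → Vr x [ y / z ] ≈ Vr (renVar y z x))
      (rnAp  : ∀ m n y z → Ap m n [ y / z ] ≈ Ap (m [ y / z ]) (n [ y / z ]))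
      (rnLm  : ∀ x m y z → x ≢ y → x ≢ z → Lm x m [ y / z ] ≈ Lm x (m [ y / z ]))
      (rnLm₂ : ∀ x m z → Lm x m [ z / x ] ≈ Lm x m)
      (rnBvr₂ : ∀ x x′ y m → y ≢ x′ → Lm x (m [ y / x′ ]) ≈ Lm x′ ((m [ y / x′ ]) [ x′ / x ]))
      (rnIm  : ∀ m x₁ x₂ y → x₁ ≢ y → (m [ x₁ / y ]) [ x₂ / y ] ≈ m [ x₁ / y ])
      where

      _#_ : Var → M → Set ℓ
      z # m = ∃[ y ] y ≢ z × m [ y / z ] ≈ m

      #⇒unchanged : ∀ {z m} → z # m → ∀ y → m [ y / z ] ≈ m
      #⇒unchanged {z} {m} (y′ , y′≢z , e) y =
        ≈-trans (ren-cong y z (≈-sym e)) (≈-trans (rnIm m y′ y z y′≢z) e)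

      other : ∀ z → ∃[ y ] y ≢ z
      other z = fresh (z ∷ []) , ∉⇒≢ (fresh-∉ (z ∷ [])) (here refl)

      rnBvr : ∀ x z m → z ≢ x → z # m → Lm x m ≈ Lm z (m [ z / x ])
      rnBvr x z m _ (y , y≢z , e) = begin
        Lm x m                        ≈⟨ Lm-cong x e ⟨
        Lm x (m [ y / z ])            ≈⟨ rnBvr₂ x z y m y≢z ⟩
        Lm z ((m [ y / z ]) [ z / x ])  ≈⟨ Lm-cong z (ren-cong z x e) ⟩
        Lm z (m [ z / x ])            ∎

      frVr : ∀ x z → z ≢ x → z # Vr x
      frVr x z z≢x = let y , y≢z = other z in
        y , y≢z , ≈-trans (rnVr x y z) (reflexive (cong Vr (renVar-≢ y (z≢x ∘ sym))))

      frAp : ∀ m n z → z # m → z # n → z # Ap m n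
      frAp m n z z#m z#n = let y , y≢z = other z in
        y , y≢z , ≈-trans (rnAp m n y z) (Ap-cong (#⇒unchanged z#m y) (#⇒unchanged z#n y))

      frLm : ∀ x m z → z ≡ x ⊎ z # m → z # Lm x m
      frLm x m .x (inj₁ refl) = let y , y≢x = other x in y , y≢x , rnLm₂ x m y
      frLm x m z (inj₂ z#m) with z ≟ x
      ... | yes refl = frLm x m z (inj₁ refl)
      ... | no z≢x   = y , ∉⇒≢ y∉ (here refl) ,
        ≈-trans (rnLm x m y z (∉⇒≢ y∉ (there (here refl)) ∘ sym) (z≢x ∘ sym))
          (Lm-cong x (#⇒unchanged z#m y))
        where
        y = fresh (z ∷ x ∷ [])
        y∉ = fresh-∉ (z ∷ x ∷ [])

      open Renaming _[_/_] ren-cong rnVr rnAp rnLm _#_ rnBvr frVr frAp frLm public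

------------------------------------------------------------------------
-- Models with substitution

    -- Substituting variables only gives a model with renaming.
    module Substitution
      (_[_/_]  : M → M → Var → M)
      (sb-cong : ∀ {m m′ n n′} z → m ≈ m′ → n ≈ n′ → m [ n / z ] ≈ m′ [ n′ / z ])
      (sbVr : ∀ x n z → Vr x [ n / z ] ≈ (if does (x ≟ z) then n else Vr x))
      (sbAp : ∀ m₁ m₂ n z → Ap m₁ m₂ [ n / z ] ≈ Ap (m₁ [ n / z ]) (m₂ [ n / z ]))
      (_#_  : Var → M → Set ℓ)
      (sbLm : ∀ x m n z → x ≢ z → x # n → Lm x m [ n / z ] ≈ Lm x (m [ n / z ]))
      (sbBvr : ∀ x z m → z ≢ x → z # m → Lm x m ≈ Lm z (m [ Vr z / x ]))
      (frVr : ∀ x z → z ≢ x → z # Vr x)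
      (frAp : ∀ m n z → z # m → z # n → z # Ap m n)
      (frLm : ∀ x m z → z ≡ x ⊎ z # m → z # Lm x m)
      where

      open Renaming (λ m y z → m [ Vr y / z ]) (λ y z e → sb-cong z e ≈-refl)
        (λ x y z → ≈-trans (sbVr x (Vr y) z) (reflexive (sym (if-float Vr (does (x ≟ z))))))
        (λ m n y z → sbAp m n (Vr y) z)
        (λ x m y z x≢y x≢z → sbLm x m (Vr y) z x≢z (frVr y x x≢y))
        _#_ sbBvr frVr frAp frLm public using (eval-#; renames)

      eval-sb : ∀ t s z → eval (subst₁ t s z) ≈ eval t [ eval s / z ]
      eval-sb t s z = α-induction (λ t → eval (subst₁ t s z) ≈ eval t [ eval s / z ])
        (z ∷ vars s)
        (λ d e → ≈-trans (≈-sym (eval-cong renames (subst₁-cong z d (α-refl s))))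
          (≈-trans e (sb-cong z (eval-cong renames d) ≈-refl)))
        (λ x → ≈-trans (reflexive (if-float eval (does (x ≟ z)))) (≈-sym (sbVr x (eval s) z)))
        (λ t u e e′ → ≈-trans (Ap-cong e e′) (≈-sym (sbAp _ _ (eval s) z)))
        (λ x t x∉ e →
          let x≢z = ∉⇒≢ x∉ (here refl) ; x∉s = x∉ ∘ there ∘ FV⊆vars s in
          ≈-trans (eval-cong renames (subst₁-Lm t s x≢z x∉s))
            (≈-trans (Lm-cong x e) (≈-sym (sbLm x _ (eval s) z x≢z (eval-# s x∉s)))))
        t

------------------------------------------------------------------------
-- Initiality

  module _ (i : Fin 9) (𝓜 : Model (Sig i)) where

    private
      module M = Model 𝓜
      𝓑 = reduct (λ {s} → Σctor⊆Sig i {s}) 𝓜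
    open Interpretation 𝓑
    open M using (_≈_)

    -- The interpretation as a morphism out of the term model, the only one.
    extend : RenamesBinders →
      (⦃ _ : pm ∈ˢ Sig i ⦄ → ∀ t σ → eval (act ⟪ σ ⟫ t) ≈ eval t M.[ σ ]ᵖ) →
      (⦃ _ : sw ∈ˢ Sig i ⦄ → ∀ t x y → eval (act (swap x y) t) ≈ eval t M.[ x ∧ y ]) →
      (⦃ _ : sb ∈ˢ Sig i ⦄ → ∀ t s x → eval (subst₁ t s x) ≈ eval t M.[ eval s / x ]ˢ) →
      (⦃ _ : ren ∈ˢ Sig i ⦄ → ∀ t y x → eval (subst₁ t (PVr y) x) ≈ eval t M.[ y / x ]ʳ) →
      (⦃ _ : fv ∈ˢ Sig i ⦄ → ∀ t → M.FV (eval t) ⊆ FVᵖ t) →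
      (⦃ _ : fr ∈ˢ Sig i ⦄ → ∀ x t → x ∉ FVᵖ t → x M.# eval t) →
      Σ[ f ∈ Morphism (Tr (Sig i)) 𝓜 ]
        (∀ (h : Morphism (Tr (Sig i)) 𝓜) t → Morphism.g h t ≈ Morphism.g f t)
    extend renames g-pm g-sw g-sb g-ren g-FV g-# = f , λ h → eval-unique (F₁ h)
      where
      open Functor (reductFunctor (λ {s} → Σctor⊆Sig i {s})) using (F₁)

      -- The constructors of 𝓑 are those of 𝓜 for a particular proof that the
      -- signature contains them.
      proof-irrelevant : ∀ {a} {A : Set a} {b} (op : T b → A) (p q : T b) → op p ≡ op q
      proof-irrelevant op p q = cong op (T-irrelevant p q)

      f : Morphism (Tr (Sig i)) 𝓜
      f = record
        { g      = eval
        ; g-cong = eval-cong renames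
        ; g-Vr   = λ ⦃ p ⦄ x → Setoid.reflexive M.setoid
            (proof-irrelevant (λ q → M.Vr ⦃ q ⦄ x) _ p)
        ; g-Ap   = λ ⦃ p ⦄ t u → Setoid.reflexive M.setoid
            (proof-irrelevant (λ q → M.Ap ⦃ q ⦄ (eval t) (eval u)) _ p)
        ; g-Lm   = λ ⦃ p ⦄ x t → Setoid.reflexive M.setoid
            (proof-irrelevant (λ q → M.Lm ⦃ q ⦄ x (eval t)) _ p)
        ; g-pm   = g-pm
        ; g-sw   = g-sw
        ; g-sb   = g-sb
        ; g-ren  = g-ren
        ; g-FV   = g-FV
        ; g-#    = g-#
        }

  Tr-initial : ExcludedMiddle ℓ → ∀ i →
               IsInitial (ModelsOf (Sig i) (Props i)) (Tr (Sig i) , Tr⊨ (Props i))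
  Tr-initial em 0F (𝓜 , (_ , pmVr) ∷ (_ , pmAp) ∷ (_ , pmLm) ∷ _ ∷ _ ∷
                        (_ , fvD) ∷ (_ , fcb) ∷ []) =
    extend 0F 𝓜 renames eval-pm
      (λ { ⦃ () ⦄ }) (λ { ⦃ () ⦄ }) (λ { ⦃ () ⦄ }) (λ t → eval-FV t) (λ { ⦃ () ⦄ })
    where
    open Model 𝓜
    open Interpretation (reduct (λ {s} → Σctor⊆Sig 0F {s}) 𝓜)
    open Permuting _[_]ᵖ (λ σ e → pm-cong σ σ e λ _ → refl) pmVr pmAp pmLm
    open Nominal em FV (λ m → proj₁ (fvD m)) (λ m → proj₂ (fvD m)) fcb
  Tr-initial em 1F (𝓜 , (_ , pmVr) ∷ (_ , pmAp) ∷ (_ , pmLm) ∷ _ ∷ _ ∷ (_ , pmFv) ∷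
                        (_ , fvVr) ∷ (_ , fvAp) ∷ (_ , fvLm) ∷ []) =
    extend 1F 𝓜 renames eval-pm
      (λ { ⦃ () ⦄ }) (λ { ⦃ () ⦄ }) (λ { ⦃ () ⦄ }) (λ t → eval-FV t) (λ { ⦃ () ⦄ })
    where
    open Model 𝓜
    open Interpretation (reduct (λ {s} → Σctor⊆Sig 1F {s}) 𝓜)
    open Permuting _[_]ᵖ (λ σ e → pm-cong σ σ e λ _ → refl) pmVr pmAp pmLm

    swFv : ∀ m x y → x ∉ FV m → y ∉ FV m → m [ transposition x y ]ᵖ ≈ m
    swFv m x y x∉ y∉ = pmFv m (transposition x y) λ v (v∈supp , v∈) →
      v∈supp (swap-≢ x y (λ { refl → x∉ v∈ }) (λ { refl → y∉ v∈ }))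

    open Free FV swFv (λ x → fvVr x) (λ m n → fvAp m n) (λ x m → fvLm x m)
  Tr-initial em 2F (𝓜 , (_ , swVr) ∷ (_ , swAp) ∷ (_ , swLm) ∷ _ ∷ _ ∷ _ ∷
                        (_ , fvD) ∷ (_ , fcb) ∷ []) =
    extend 2F 𝓜 renames (λ { ⦃ () ⦄ }) eval-sw (λ { ⦃ () ⦄ }) (λ { ⦃ () ⦄ }) (λ t → eval-FV t) (λ { ⦃ () ⦄ })
    where
    open Model 𝓜
    open Interpretation (reduct (λ {s} → Σctor⊆Sig 2F {s}) 𝓜)
    open Swapping _[_∧_] (λ x y → sw-cong x y) swVr swAp swLm
    open Nominal em FV (λ m → proj₁ (fvD m)) (λ m → proj₂ (fvD m)) fcb
  Tr-initial em 3F (𝓜 , (_ , swVr) ∷ (_ , swAp) ∷ (_ , swLm) ∷ (_ , swFv) ∷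
                        (_ , fvVr) ∷ (_ , fvAp) ∷ (_ , fvLm) ∷ []) =
    extend 3F 𝓜 renames (λ { ⦃ () ⦄ }) eval-sw (λ { ⦃ () ⦄ }) (λ { ⦃ () ⦄ }) (λ t → eval-FV t) (λ { ⦃ () ⦄ })
    where
    open Model 𝓜
    open Interpretation (reduct (λ {s} → Σctor⊆Sig 3F {s}) 𝓜)
    open Swapping _[_∧_] (λ x y → sw-cong x y) swVr swAp swLm
    open Free FV swFv (λ x → fvVr x) (λ m n → fvAp m n) (λ x m → fvLm x m)
  Tr-initial em 4F (𝓜 , (_ , swVr) ∷ (_ , swAp) ∷ (_ , swLm) ∷ (_ , swBvr) ∷
                        (_ , frVr) ∷ (_ , frAp) ∷ (_ , frLm) ∷ []) =
    extend 4F 𝓜 (bvr⇒renames swBvr)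
      (λ { ⦃ () ⦄ }) eval-sw (λ { ⦃ () ⦄ }) (λ { ⦃ () ⦄ }) (λ { ⦃ () ⦄ }) (λ _ t → eval-# t)
    where
    open Model 𝓜
    open Interpretation (reduct (λ {s} → Σctor⊆Sig 4F {s}) 𝓜)
    open Swapping _[_∧_] (λ x y → sw-cong x y) swVr swAp swLm
    open Fresh _#_ frVr frAp frLm
  Tr-initial em 5F (𝓜 , (_ , swVr) ∷ (_ , swAp) ∷ (_ , swLm) ∷ (_ , swCg) ∷
                        (_ , frVr) ∷ (_ , frAp) ∷ (_ , frLm) ∷ []) =
    extend 5F 𝓜 (cg⇒renames swCg)
      (λ { ⦃ () ⦄ }) eval-sw (λ { ⦃ () ⦄ }) (λ { ⦃ () ⦄ }) (λ { ⦃ () ⦄ }) (λ _ t → eval-# t)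
    where
    open Model 𝓜
    open Interpretation (reduct (λ {s} → Σctor⊆Sig 5F {s}) 𝓜)
    open Swapping _[_∧_] (λ x y → sw-cong x y) swVr swAp swLm
    open Fresh _#_ frVr frAp frLm
  Tr-initial em 6F (𝓜 , (_ , sbVr) ∷ (_ , sbAp) ∷ (_ , sbLm) ∷ (_ , sbBvr) ∷
                        (_ , frVr) ∷ (_ , frAp) ∷ (_ , frLm) ∷ []) =
    extend 6F 𝓜 renames
      (λ { ⦃ () ⦄ }) (λ { ⦃ () ⦄ }) eval-sb (λ { ⦃ () ⦄ }) (λ { ⦃ () ⦄ }) (λ _ t → eval-# t)
    where
    open Model 𝓜
    open Interpretation (reduct (λ {s} → Σctor⊆Sig 6F {s}) 𝓜)
    open Substitution _[_/_]ˢ (λ z → sb-cong z) sbVr sbAp _#_ sbLm sbBvr frVr frAp frLm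
  Tr-initial em 7F (𝓜 , (_ , rnVr) ∷ (_ , rnAp) ∷ (_ , rnLm₁) ∷ (_ , rnLm₂) ∷ (_ , rnBvr₂) ∷
                        _ ∷ (_ , rnIm) ∷ _ ∷ _ ∷ []) =
    extend 7F 𝓜 renames
      (λ { ⦃ () ⦄ }) (λ { ⦃ () ⦄ }) (λ { ⦃ () ⦄ }) eval-ren (λ { ⦃ () ⦄ }) (λ { ⦃ () ⦄ })
    where
    open Model 𝓜
    open Interpretation (reduct (λ {s} → Σctor⊆Sig 7F {s}) 𝓜)
    open RenamingOnly _[_/_]ʳ (λ y z → ren-cong y z) rnVr rnAp rnLm₁ rnLm₂ rnBvr₂ rnIm
  Tr-initial em 8F (𝓜 , (_ , rnVr) ∷ (_ , rnAp) ∷ (_ , rnLm₁) ∷ (_ , rnBvr) ∷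
                        (_ , frVr) ∷ (_ , frAp) ∷ (_ , frLm) ∷ []) =
    extend 8F 𝓜 renames
      (λ { ⦃ () ⦄ }) (λ { ⦃ () ⦄ }) (λ { ⦃ () ⦄ }) eval-ren (λ { ⦃ () ⦄ }) (λ _ t → eval-# t)
    where
    open Model 𝓜
    open Interpretation (reduct (λ {s} → Σctor⊆Sig 8F {s}) 𝓜)
    open Renaming _[_/_]ʳ (λ y z → ren-cong y z) rnVr rnAp rnLm₁ _#_ rnBvr frVr frAp frLm

mainTheorem1 : ∀ {ℓ} → ExcludedMiddle ℓ → (Var : Set ℓ) (enum : Var ↔ ℕ) →
    let open Lambda Var enum in
    ∀ (i : Fin 9) → Σ[ sat ∈ Tr (Sig i) ⊨* Props i ] IsEpiRecursor (r i sat)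
mainTheorem1 em Var enum i = Tr⊨ (Props i) , record
  { I-initial = Tr-initial em i
  ; RI≡T      = refl
  }
  where
  open Lambda Var enum
  open Terms Var enum
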